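{- Let $k$ be a positive integer, let $n\ge \frac{9}{2}k^2+\frac{13}{4}k+\frac{49}{32}$ be an integer, and let $\alpha\in\{ -1,1\}$. Then $$\mathrm{lbal}(n,C_{4k+\alpha})=\mathrm{bal}(n,C_{4k+\alpha})=\mathrm{bal}(n,P_{4k+\alpha-1})=(k-1)n-\frac{1}{2}\left(k^2-k-1-\alpha\right).$$
   Context: $C_\ell$ is the cycle on $\ell$ vertices, and $P_\ell$ is the path with $\ell$ edges (hence $\ell+1$ vertices). A 2-coloring of the edges of $K_n$ is a partition $E(K_n)=R\sqcup B$ (red edges and blue edges). A 2-list coloring of the edges of $K_n$ is a function $L:E(K_n)\to\{\{r\},\{b\},\{r,b\}\}$; it induces color classes $R=\{e: r\in L(e)\}$ and $B=\{e: b\in L(e)\}$ (which may intersect). Given a 2-coloring or a 2-list coloring with color classes $R,B$, a balanced copy of a graph $G=G(V,E)$ is a (not necessarily induced) copy of $G$ in $K_n$ whose edge set has a partition $E_1\sqcup E_2$ with $E_1\subseteq R$, $E_2\subseteq B$ and $\bigl||E_1|-|E_2|\bigr|\le 1$. Balancing number: $\mathrm{bal}(n,G)$ is the smallest integer $k$ such that every 2-coloring $R\sqcup B$ of the edges of $K_n$ with $|R|,|B|>k$ contains a balanced copy of $G$, where the condition $|R|,|B|>k$ is required to be satisfiable by some 2-coloring, i.e. $2(k+1)\le\binom{n}{2}$. List balancing number: for $n\ge |V|$, $\mathrm{lbal}(n,G)$ is the smallest integer $k$ such that every 2-list coloring of the edges of $K_n$ with color classes satisfying $|R|,|B|>k$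 contains a balanced copy of $G$. -}

module Defs where

open import Data.Fin using (Fin; toℕ)
import Data.Fin.Properties as Fin
open import Data.Integer as ℤ using (ℤ; +_)
open import Data.List using (List; length; filter; allFin; cartesianProduct)
open import Data.Nat as ℕ using (ℕ; suc; ∣_-_∣)
open import Data.Nat.Combinatorics using () renaming (_C_ to _choose_)
import Data.Nat.Properties as ℕ
open import Data.Product using (_×_; _,_; Σ; proj₁; proj₂)
open import Data.Rational.Unnormalised using (ℚᵘ; _/_)
open import Data.Sum using (_⊎_; inj₁; inj₂)
import Data.Sum as Sum
open import Function.Definitions using (Injective)
open import Level using (0ℓ)
open import Relation.Binary.Core using (Rel)
open import Relation.Binary.Definitions using (Decidable; Symmetric; Irreflexive)
open import Relation.Binary.PropositionalEquality
  using (_≡_; _≢_; refl; subst; ≢-sym)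
open import Relation.Nullary using (¬_; yes; no; ¬?)
open import Relation.Nullary.Decidable using (_×-dec_; _⊎-dec_)

private
  variable
    m n : ℕ

record Graph (n : ℕ) : Set₁ where
  field
    Adj        : Rel (Fin n) 0ℓ
    adj?       : Decidable Adj
    adj-sym    : Symmetric Adj
    adj-irrefl : Irreflexive _≡_ Adj

open Graph public

-- Each unordered pair of distinct vertices is listed once, as (u , v) with u < v.

pairs : ∀ n → List (Fin n × Fin n)
pairs n = filter (λ e → proj₁ e Fin.<? proj₂ e) (cartesianProduct (allFin n) (allFin n))

size : Graph n → ℕ
size {n} G = length (filter (λ e → adj? G (proj₁ e) (proj₂ e)) (pairs n))

complete : ∀ n → Graph n
complete n = record
  { Adj        = _≢_
  ; adj?       = λ u v → ¬? (u Fin.≟ v)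
  ; adj-sym    = ≢-sym
  ; adj-irrefl = λ u≡v u≢v → u≢v u≡v
  }

-- P ℓ has ℓ edges.

P : ∀ ℓ → Graph (suc ℓ)
P ℓ = record
  { Adj        = λ u v → Next u v ⊎ Next v u
  ; adj?       = λ u v → next? u v ⊎-dec next? v u
  ; adj-sym    = Sum.swap
  ; adj-irrefl = λ { refl (inj₁ p) → ℕ.1+n≢n p ; refl (inj₂ p) → ℕ.1+n≢n p }
  }
  where
  Next : Rel (Fin (suc ℓ)) 0ℓ
  Next u v = suc (toℕ u) ≡ toℕ v

  next? : Decidable Next
  next? u v = suc (toℕ u) ℕ.≟ toℕ v

-- C ℓ has ℓ vertices; it is a cycle when ℓ ≥ 3.  The conjunct u ≢ v only
-- matters for ℓ = 1, where it removes a loop.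

C : ∀ ℓ → Graph ℓ
C ℓ = record
  { Adj        = λ u v → u ≢ v × (Next u v ⊎ Next v u)
  ; adj?       = λ u v → ¬? (u Fin.≟ v) ×-dec (next? u v ⊎-dec next? v u)
  ; adj-sym    = λ (u≢v , p) → ≢-sym u≢v , Sum.swap p
  ; adj-irrefl = λ u≡v (u≢v , _) → u≢v u≡v
  }
  where
  Next : Rel (Fin ℓ) 0ℓ
  Next u v = suc (toℕ u) ≡ toℕ v ⊎ (suc (toℕ u) ≡ ℓ × toℕ v ≡ 0)

  next? : Decidable Next
  next? u v = (suc (toℕ u) ℕ.≟ toℕ v) ⊎-dec ((suc (toℕ u) ℕ.≟ ℓ) ×-dec (toℕ v ℕ.≟ 0))

-- E(G) = E(E₁) ⊔ E(E₂), the parts being spanning subgraphs of G.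

record Partition (G : Graph n) : Set₁ where
  field
    E₁ E₂    : Graph n
    E₁⊆G     : ∀ {u v} → Adj E₁ u v → Adj G u v
    E₂⊆G     : ∀ {u v} → Adj E₂ u v → Adj G u v
    covers   : ∀ {u v} → Adj G u v → Adj E₁ u v ⊎ Adj E₂ u v
    disjoint : ∀ {u v} → Adj E₁ u v → ¬ Adj E₂ u v

TwoColoring : ℕ → Set₁
TwoColoring n = Partition (complete n)

data Color : Set where
  red blue : Color

-- The non-empty sets of colors: only c is { c }, and both is { red , blue }.

data Palette : Set where
  only : Color → Palette
  both : Palette

infix 4 _∈_

data _∈_ (c : Color) : Palette → Set where
  ∈only : c ∈ only c
  ∈both : c ∈ both

_∈?_ : Decidable _∈_
red  ∈? only red  = yes ∈only
red  ∈? only blue = no λ ()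
blue ∈? only red  = no λ ()
blue ∈? only blue = yes ∈only
red  ∈? both      = yes ∈both
blue ∈? both      = yes ∈both

-- The irrelevant argument and the symmetry field make lists a function on the
-- unordered pairs of distinct vertices.

record ListColoring (n : ℕ) : Set where
  field
    lists     : (u v : Fin n) → .(u ≢ v) → Palette
    lists-sym : ∀ u v .(u≢v : u ≢ v) → lists u v u≢v ≡ lists v u (≢-sym u≢v)

colorClass : ListColoring n → Color → Graph n
colorClass {n} L c = record
  { Adj        = Class
  ; adj?       = class?
  ; adj-sym    = λ {u} {v} (u≢v , c∈) → ≢-sym u≢v , subst (c ∈_) (lists-sym u v u≢v) c∈
  ; adj-irrefl = λ u≡v (u≢v , _) → u≢v u≡v
  }
  where
  open ListColoring L

  Class : Rel (Fin n) 0ℓ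
  Class u v = Σ (u ≢ v) λ u≢v → c ∈ lists u v u≢v

  class? : Decidable Class
  class? u v with u Fin.≟ v
  ... | yes u≡v = no λ (u≢v , _) → u≢v u≡v
  ... | no  u≢v with c ∈? lists u v u≢v
  ...   | yes c∈ = yes (u≢v , c∈)
  ...   | no  c∉ = no λ (_ , c∈) → c∉ c∈

-- A copy of G is the image of G under an injection of the vertices.  The
-- partition of its edge set is given by the corresponding partition of E(G).

record BalancedCopy (R B : Graph n) (G : Graph m) : Set₁ where
  field
    embed     : Fin m → Fin n
    injective : Injective _≡_ _≡_ embed
    partition : Partition G
  open Partition partition public
  field
    E₁⊆R      : ∀ {u v} → Adj E₁ u v → Adj R (embed u) (embed v)
    E₂⊆B      : ∀ {u v} → Adj E₂ u v → Adj B (embed u) (embed v)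
    balanced  : ∣ size E₁ - size E₂ ∣ ℕ.≤ 1

IsLeast : ∀ {ℓ} → (ℤ → Set ℓ) → ℤ → Set ℓ
IsLeast Q k = Q k × (∀ j → Q j → k ℤ.≤ j)

-- The first conjunct holds exactly when some 2-coloring has |R|, |B| > k.

BalBound : ∀ n → Graph m → ℤ → Set₁
BalBound n G k =
  (+ 2 ℤ.* (k ℤ.+ + 1) ℤ.≤ + (n choose 2)) ×
  ((χ : TwoColoring n) → let open Partition χ renaming (E₁ to R; E₂ to B) in
    k ℤ.< + size R → k ℤ.< + size B → BalancedCopy R B G)

LbalBound : ∀ n → Graph m → ℤ → Set₁
LbalBound n G k =
  (L : ListColoring n) → let R = colorClass L red; B = colorClass L blue in
    k ℤ.< + size R → k ℤ.< + size B → BalancedCopy R B G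

-- bal(n,G) and lbal(n,G) are partial, so they are given by their graphs:
-- IsBal n G k means that bal(n,G) is defined and equal to k.

IsBal : ∀ n → Graph m → ℤ → Set₁
IsBal n G = IsLeast (BalBound n G)

IsLbal : ∀ n → Graph m → ℤ → Set₁
IsLbal {m} n G k = m ℕ.≤ n × IsLeast (LbalBound n G) k

fromℤ : ℤ → ℚᵘ
fromℤ i = i / 1

module Submission where

-- Write m = 2k - 1 or m = 2k for the number of edges of each colour in a balanced path with
-- 2m edges, i.e. 2m + 1 = 4k + α.
--
-- Upper bound. Sliding a path with 2m edges along a longer one changes its number of red edges
-- by at most one per step, so a path with at least m red edges and a path with at least m blue
-- edges force a balanced one. Such paths exist as soon as both colour classes contain a linear
-- forest with m edges, and for large n more than b edges force such a forest: a vertex of large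
-- degree carries a cherry disjoint from a forest with m - 2 edges in its complement, and if all
-- degrees are small a matching is found greedily. Closing the balanced path gives the cycle.
--
-- Lower bound. Colour red all edges meeting a fixed set of k - 1 vertices and, if α = 1, one
-- further edge. A cycle has at most 2 (k - 1) edges meeting the set, hence fewer than m red ones.

-- With `j = k - 1` and `ε = (1 + α) / 2` the claimed value is `j n - j (j + 1) / 2 + ε`: the number
-- of edges meeting `j` vertices, plus `ε`. Raising both `j` and `n` by one raises it by the old
-- `n`, the largest degree possible in the larger graph. So deleting one vertex costs the induction
-- nothing, while the number of wanted edges drops by the two edges of a cherry. The lower bound on
-- `n` pays for the case of small degrees.
--
-- The obstacle to sliding is that the two heavy paths may share vertices in an unfavourable order,
-- so that a window reaching from one into the other repeats a vertex; a third path in between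
-- resolves this. In a list coloring an edge may carry both colours, so every path comes with a
-- chosen colour for each edge, and the argument assumes only that `R` and `B` together contain all
-- edges. Hence it serves `bal` and `lbal` alike. The cycle has odd length `2m + 1`: its closing
-- edge takes whichever colour it admits, leaving `m` and `m + 1` edges.

module _ where

  open import Defs
    using (Graph; Adj; adj?; adj-sym; adj-irrefl; pairs; size; complete; P; C;
           Partition; Color; red; blue; BalancedCopy; TwoColoring)
  open import Data.Empty using (⊥-elim)
  open import Data.Fin using (Fin; toℕ; zero; suc; fromℕ; fromℕ<; inject₁)
  import Data.Fin.Properties as Fin
  open import Data.List
    using (List; []; _∷_; _++_; length; map; filter; allFin; tabulate; cartesianProduct; upTo)
  open import Data.List.Membership.DecPropositional using (_∈?_)
  open import Data.List.Membership.Propositional using (_∈_; _∉_; find; lose)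
  open import Data.List.Membership.Propositional.Properties
    using (∈-∃++; ∈-filter⁺; ∈-filter⁻; ∈-map⁺; ∈-map⁻; ∈-++⁺ˡ; ∈-++⁺ʳ; ∈-allFin; ∈-upTo⁺;
           ∈-cartesianProduct⁺)
  open import Data.List.Properties
    using (filter-accept; filter-reject; filter-none; filter-all; filter-++; length-++;
           length-filter; length-map; length-tabulate; length-upTo)
  open import Data.List.Relation.Binary.Permutation.Propositional
    using (_↭_; refl; prep; swap; trans; ↭-sym; ↭⇒↭ₛ)
  open import Data.List.Relation.Binary.Permutation.Propositional.Properties
    using (↭-length; ∈-resp-↭; filter-↭; shift)
  open import Data.List.Relation.Binary.Permutation.Setoid.Properties using (Unique-resp-↭)
  open import Data.List.Relation.Unary.All as All using (All; []; _∷_)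
  import Data.List.Relation.Unary.All.Properties as AllP
  open import Data.List.Relation.Unary.AllPairs using (AllPairs; []; _∷_)
  import Data.List.Relation.Unary.AllPairs.Properties as AllPairsP
  open import Data.List.Relation.Unary.Any as Any using (here; there)
  open import Data.List.Relation.Unary.Unique.Propositional using (Unique)
  import Data.List.Relation.Unary.Unique.Propositional.Properties as Unique
  open import Data.Nat
  open import Data.Nat.Combinatorics using (nC1≡n; nCk+nC[k+1]≡[n+1]C[k+1]) renaming (_C_ to _choose_)
  open import Data.Nat.Properties
  open import Data.Nat.Tactic.RingSolver using (solve-∀)
  open import Data.Product using (∃-syntax; _×_; _,_; proj₁; proj₂)
  open import Data.Sum using (_⊎_; inj₁; inj₂)
  import Data.Sum as Sum
  open import Function using (_∘_; id)
  open import Level using (Level)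
  open import Relation.Binary.Definitions using (tri<; tri≈; tri>)
  open import Relation.Binary.PropositionalEquality
    using (_≡_; _≢_; refl; sym; cong; cong₂; subst; setoid; module ≡-Reasoning)
    renaming (trans to ≡-trans)
  open import Relation.Nullary using (Dec; yes; no; ¬_; ¬?)
  open import Relation.Nullary.Decidable using (_×-dec_; _⊎-dec_)
  open import Relation.Unary using (Pred; Decidable)

  private
    variable
      a p q : Level
      A B : Set a
      m n d : ℕ
      x : A
      xs ys : List A

  -- Linear arithmetic by certificate: p ≤ q follows from a ≤ b once
  -- q - p = (b - a) + s is checked with both sides moved so that no subtraction occurs.
  lin-≤ : ∀ {a b p q} s → a ≤ b → p + b + s ≡ q + a → p ≤ q
  lin-≤ {a} {b} {p} {q} s a≤b eq = +-cancelʳ-≤ a p q (begin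
    p + a      ≤⟨ +-monoʳ-≤ p a≤b ⟩
    p + b      ≤⟨ m≤m+n (p + b) s ⟩
    p + b + s  ≡⟨ eq ⟩
    q + a      ∎)
    where open ≤-Reasoning

  -- Counting edges

  remove : x ∈ xs → ∃[ ys ] xs ↭ x ∷ ys
  remove {x = x} x∈ with ∈-∃++ x∈
  ... | us , vs , refl = us ++ vs , shift x us vs

  unique-resp-↭ : xs ↭ ys → Unique xs → Unique ys
  unique-resp-↭ σ = Unique-resp-↭ (setoid _) (↭⇒↭ₛ σ)

  unique-⊆⇒length≤ : Unique xs → (∀ {x} → x ∈ xs → x ∈ ys) → length xs ≤ length ys
  unique-⊆⇒length≤ [] xs⊆ys = z≤n
  unique-⊆⇒length≤ {xs = x ∷ xs} (x∉ ∷ uxs) xs⊆ys with remove (xs⊆ys (here refl))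
  ... | zs , σ rewrite ↭-length σ = s≤s (unique-⊆⇒length≤ uxs xs⊆zs)
    where
    xs⊆zs : ∀ {z} → z ∈ xs → z ∈ zs
    xs⊆zs z∈ with ∈-resp-↭ σ (xs⊆ys (there z∈))
    ... | here refl = ⊥-elim (All.lookup x∉ z∈ refl)
    ... | there z∈zs = z∈zs

  module _ {P : Pred A p} {Q : Pred A q} (P? : Decidable P) (Q? : Decidable Q) where

    length-filter-⊆ : (∀ {x} → P x → Q x) → ∀ xs →
                      length (filter P? xs) ≤ length (filter Q? xs)
    length-filter-⊆ P⊆Q [] = z≤n
    length-filter-⊆ P⊆Q (x ∷ xs) with P? x | Q? x
    ... | yes _  | yes _ = s≤s (length-filter-⊆ P⊆Q xs)
    ... | yes px | no ¬q = ⊥-elim (¬q (P⊆Q px))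
    ... | no _   | yes _ = m≤n⇒m≤1+n (length-filter-⊆ P⊆Q xs)
    ... | no _   | no _  = length-filter-⊆ P⊆Q xs

  length-filter-∪ : {P : Pred A p} {Q R : Pred A q}
                    (P? : Decidable P) (Q? : Decidable Q) (R? : Decidable R) →
                    (∀ {x} → P x → Q x ⊎ R x) → ∀ xs →
                    length (filter P? xs) ≤ length (filter Q? xs) + length (filter R? xs)
  length-filter-∪ P? Q? R? P⊆ [] = z≤n
  length-filter-∪ P? Q? R? P⊆ (x ∷ xs)
    with ih ← length-filter-∪ P? Q? R? P⊆ xs | P? x | Q? x | R? x
  ... | yes _  | yes _ | yes _ = s≤s (≤-trans ih (+-monoʳ-≤ _ (n≤1+n _)))
  ... | yes _  | yes _ | no _  = s≤s ih
  ... | yes _  | no _  | yes _ rewrite +-suc (length (filter Q? xs)) (length (filter R? xs)) = s≤s ih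
  ... | yes px | no ¬q | no ¬r with P⊆ px
  ...   | inj₁ qx = ⊥-elim (¬q qx)
  ...   | inj₂ rx = ⊥-elim (¬r rx)
  length-filter-∪ P? Q? R? P⊆ (x ∷ xs) | no _ | yes _ | yes _ =
    m≤n⇒m≤1+n (≤-trans ih (+-monoʳ-≤ _ (n≤1+n _)))
  length-filter-∪ P? Q? R? P⊆ (x ∷ xs) | no _ | yes _ | no _ = m≤n⇒m≤1+n ih
  length-filter-∪ P? Q? R? P⊆ (x ∷ xs) | no _ | no _ | yes _ = ≤-trans ih (+-monoʳ-≤ _ (n≤1+n _))
  length-filter-∪ P? Q? R? P⊆ (x ∷ xs) | no _ | no _ | no _ = ih

  size-⊆ : (G H : Graph n) → (∀ {u v} → Adj G u v → Adj H u v) → size G ≤ size H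
  size-⊆ {n} G H G⊆H = length-filter-⊆ _ _ G⊆H (pairs n)

  size-∪ : (G H K : Graph n) → (∀ {u v} → Adj G u v → Adj H u v ⊎ Adj K u v) →
           size G ≤ size H + size K
  size-∪ {n} G H K G⊆ = length-filter-∪ _ _ _ G⊆ (pairs n)

  module _ (G : Graph n) where

    deg : Fin n → List (Fin n) → ℕ
    deg v xs = length (filter (adj? G v) xs)

    -- Each edge is counted at whichever end comes first in the list. The count does not depend on
    -- the order (`edges-↭`), so any vertex can be moved to the front and deleted; induced subgraphs
    -- are handled as vertex lists in this way.
    edges : List (Fin n) → ℕ
    edges []       = 0
    edges (v ∷ xs) = deg v xs + edges xs

    deg-∷-adj : ∀ {u v} xs → Adj G u v → deg u (v ∷ xs) ≡ suc (deg u xs)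
    deg-∷-adj xs uv = cong length (filter-accept (adj? G _) uv)

    deg-∷-¬adj : ∀ {u v} xs → ¬ Adj G u v → deg u (v ∷ xs) ≡ deg u xs
    deg-∷-¬adj xs ¬uv = cong length (filter-reject (adj? G _) ¬uv)

    deg-↭ : ∀ v → xs ↭ ys → deg v xs ≡ deg v ys
    deg-↭ v σ = ↭-length (filter-↭ (adj? G v) σ)

    deg-∷-self : ∀ v xs → deg v (v ∷ xs) ≡ deg v xs
    deg-∷-self v xs = deg-∷-¬adj xs (adj-irrefl G refl)

    edges-swap : ∀ u v xs → edges (u ∷ v ∷ xs) ≡ edges (v ∷ u ∷ xs)
    edges-swap u v xs with adj? G u v
    ... | yes uv rewrite deg-∷-adj xs (adj-sym G uv) =
      cong suc (eq (deg u xs) (deg v xs) (edges xs))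
      where
      eq : ∀ a b c → a + (b + c) ≡ b + (a + c)
      eq = solve-∀
    ... | no ¬uv rewrite deg-∷-¬adj xs (λ vu → ¬uv (adj-sym G vu)) =
      eq (deg u xs) (deg v xs) (edges xs)
      where
      eq : ∀ a b c → a + (b + c) ≡ b + (a + c)
      eq = solve-∀

    edges-↭ : xs ↭ ys → edges xs ≡ edges ys
    edges-↭ refl = refl
    edges-↭ (prep x σ) = cong₂ _+_ (deg-↭ x σ) (edges-↭ σ)
    edges-↭ (swap {xs} {ys} x y σ) =
      ≡-trans (cong₂ _+_ (deg-↭ x (prep y σ)) (cong₂ _+_ (deg-↭ y σ) (edges-↭ σ)))
              (edges-swap x y ys)
    edges-↭ (trans σ τ) = ≡-trans (edges-↭ σ) (edges-↭ τ)

    private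
      lt? : Decidable (λ (e : Fin n × Fin n) → toℕ (proj₁ e) < toℕ (proj₂ e))
      lt? e = proj₁ e Fin.<? proj₂ e

      adjPair? : Decidable (λ (e : Fin n × Fin n) → Adj G (proj₁ e) (proj₂ e))
      adjPair? e = adj? G (proj₁ e) (proj₂ e)

      countPairs : List (Fin n × Fin n) → ℕ
      countPairs es = length (filter adjPair? (filter lt? es))

      count-++ : ∀ es fs → countPairs (es ++ fs) ≡ countPairs es + countPairs fs
      count-++ es fs rewrite filter-++ lt? es fs
                           | filter-++ adjPair? (filter lt? es) (filter lt? fs) =
        length-++ (filter adjPair? (filter lt? es))

      count-row : ∀ u xs → All (λ v → toℕ u < toℕ v) xs → countPairs (map (u ,_) xs) ≡ deg u xs
      count-row u [] [] = refl
      count-row u (v ∷ xs) (u<v ∷ u<xs)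
        rewrite filter-accept lt? {xs = map (u ,_) xs} u<v with adj? G u v
      ... | yes _ = cong suc (count-row u xs u<xs)
      ... | no _  = count-row u xs u<xs

      count-skip : ∀ u v xs → ¬ (toℕ u < toℕ v) →
                   countPairs (map (u ,_) (v ∷ xs)) ≡ countPairs (map (u ,_) xs)
      count-skip u v xs u≮v rewrite filter-reject lt? {x = u , v} {xs = map (u ,_) xs} u≮v = refl

      count-column : ∀ us v xs → All (λ u → ¬ (toℕ u < toℕ v)) us →
                     countPairs (cartesianProduct us (v ∷ xs)) ≡ countPairs (cartesianProduct us xs)
      count-column [] v xs [] = refl
      count-column (u ∷ us) v xs (u≮v ∷ us≮v) = begin
        countPairs (cartesianProduct (u ∷ us) (v ∷ xs))
          ≡⟨ count-++ (map (u ,_) (v ∷ xs)) (cartesianProduct us (v ∷ xs)) ⟩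
        countPairs (map (u ,_) (v ∷ xs)) + countPairs (cartesianProduct us (v ∷ xs))
          ≡⟨ cong₂ _+_ (count-skip u v xs u≮v) (count-column us v xs us≮v) ⟩
        countPairs (map (u ,_) xs) + countPairs (cartesianProduct us xs)
          ≡⟨ count-++ (map (u ,_) xs) (cartesianProduct us xs) ⟨
        countPairs (cartesianProduct (u ∷ us) xs) ∎
        where open ≡-Reasoning

      -- In a sorted list the row of the head contributes its later neighbours, and the column of
      -- the head contributes nothing to later rows, because only pairs in increasing order are
      -- kept.
      count-square : ∀ xs → AllPairs (λ u v → toℕ u < toℕ v) xs →
                     countPairs (cartesianProduct xs xs) ≡ edges xs
      count-square [] [] = refl
      count-square (x ∷ xs) (x<xs ∷ sorted) = begin
        countPairs (cartesianProduct (x ∷ xs) (x ∷ xs))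
          ≡⟨ count-++ (map (x ,_) (x ∷ xs)) (cartesianProduct xs (x ∷ xs)) ⟩
        countPairs (map (x ,_) (x ∷ xs)) + countPairs (cartesianProduct xs (x ∷ xs))
          ≡⟨ cong₂ _+_ (count-skip x x xs (<-irrefl refl))
                       (count-column xs x xs (All.map (λ x<u u<x → <-asym x<u u<x) x<xs)) ⟩
        countPairs (map (x ,_) xs) + countPairs (cartesianProduct xs xs)
          ≡⟨ cong₂ _+_ (count-row x xs x<xs) (count-square xs sorted) ⟩
        deg x xs + edges xs ∎
        where open ≡-Reasoning

    size≡edges : size G ≡ edges (allFin n)
    size≡edges = count-square (allFin n) (AllPairsP.tabulate⁺-< (λ i<j → i<j))

  Joins : ∀ {ℓ} {V : Set ℓ} → V × V → V → V → Set ℓ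
  Joins (x , y) u v = (u ≡ x × v ≡ y) ⊎ (u ≡ y × v ≡ x)

  Joins-sym : ∀ {ℓ} {V : Set ℓ} {e : V × V} {u v} → Joins e v u → Joins e u v
  Joins-sym (inj₁ (p , q)) = inj₂ (q , p)
  Joins-sym (inj₂ (p , q)) = inj₁ (q , p)

  -- Once the listed pairs are put in increasing order, every edge occurs among them, and `pairs`
  -- has no repetitions. Upper bounds on `size` thus reduce to naming a covering list.
  size≤length : (G : Graph n) (es : List (Fin n × Fin n)) →
                (∀ {u v} → Adj G u v → ∃[ e ] e ∈ es × Joins e u v) →
                size G ≤ length es
  size≤length {n} G es cover = begin
    size G                    ≤⟨ unique-⊆⇒length≤ unique ⊆sorted ⟩
    length (map order es)     ≡⟨ length-map order es ⟩
    length es                 ∎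
    where
    open ≤-Reasoning

    order : Fin n × Fin n → Fin n × Fin n
    order (x , y) with x Fin.<? y
    ... | yes _ = x , y
    ... | no _  = y , x

    order-joins : ∀ e {u v} → Joins e u v → toℕ u < toℕ v → (u , v) ≡ order e
    order-joins (x , y) joins u<v with x Fin.<? y | joins
    ... | yes _   | inj₁ (refl , refl) = refl
    ... | yes x<y | inj₂ (refl , refl) = ⊥-elim (<-asym u<v x<y)
    ... | no x≮y  | inj₁ (refl , refl) = ⊥-elim (x≮y u<v)
    ... | no _    | inj₂ (refl , refl) = refl

    unique : Unique (filter (λ e → adj? G (proj₁ e) (proj₂ e)) (pairs n))
    unique = Unique.filter⁺ _
      (Unique.filter⁺ _ (Unique.cartesianProduct⁺ (Unique.allFin⁺ n) (Unique.allFin⁺ n)))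

    ⊆sorted : ∀ {e} → e ∈ filter (λ e → adj? G (proj₁ e) (proj₂ e)) (pairs n) →
              e ∈ map order es
    ⊆sorted {e} e∈ with ∈-filter⁻ (λ e → adj? G (proj₁ e) (proj₂ e)) {xs = pairs n} e∈
    ... | e∈pairs , uv with ∈-filter⁻ (λ e → proj₁ e Fin.<? proj₂ e)
                              {xs = cartesianProduct (allFin n) (allFin n)} e∈pairs
    ... | _ , u<v with cover uv
    ... | d , d∈es , joins = subst (_∈ map order es) (sym (order-joins d joins u<v))
                                   (∈-map⁺ order d∈es)

  -- Linear forests in dense graphs

  -- The triangular numbers. Inequalities carry `tri j` on the larger side instead of subtracting
  -- `j (j + 1) / 2`.
  tri : ℕ → ℕ
  tri zero    = 0
  tri (suc j) = suc j + tri j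

  tri+tri : ∀ j → tri j + tri j ≡ j * suc j
  tri+tri zero    = refl
  tri+tri (suc j) = begin
    tri (suc j) + tri (suc j)        ≡⟨ eq₁ j (tri j) ⟩
    suc j + suc j + (tri j + tri j)  ≡⟨ cong (suc j + suc j +_) (tri+tri j) ⟩
    suc j + suc j + j * suc j        ≡⟨ eq₂ j ⟩
    suc j * suc (suc j)              ∎
    where
    open ≡-Reasoning

    eq₁ : ∀ j t → (suc j + t) + (suc j + t) ≡ suc j + suc j + (t + t)
    eq₁ = solve-∀

    eq₂ : ∀ j → suc j + suc j + j * suc j ≡ suc j * suc (suc j)
    eq₂ = solve-∀

  -- The bound on n in the theorem reads threshold k ≤ 32 n.
  threshold : ℕ → ℕ
  threshold k = 144 * (k * k) + 104 * k + 49

  indicator : {P : Set p} → Dec P → ℕ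
  indicator (yes _) = 1
  indicator (no _)  = 0

  module _ (G : Graph n) where

    -- Consecutive entries need not be adjacent, so the components of a forest can be written one
    -- after another, and prepending a vertex never loses an edge.
    walkEdges : List (Fin n) → ℕ
    walkEdges []           = 0
    walkEdges (x ∷ [])     = 0
    walkEdges (x ∷ y ∷ zs) = indicator (adj? G x y) + walkEdges (y ∷ zs)

    walkEdges-∷ : ∀ x xs → walkEdges xs ≤ walkEdges (x ∷ xs)
    walkEdges-∷ x []       = z≤n
    walkEdges-∷ x (y ∷ xs) = m≤n+m _ _

    walkEdges-∷∷ : ∀ {x y} zs → Adj G x y → suc (walkEdges (y ∷ zs)) ≤ walkEdges (x ∷ y ∷ zs)
    walkEdges-∷∷ {x} {y} zs xy with adj? G x y
    ... | yes _  = ≤-refl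
    ... | no ¬xy = ⊥-elim (¬xy xy)

    -- A linear forest with m edges inside S, given by concatenating its components.
    record Forest (m : ℕ) (S : List (Fin n)) : Set where
      field
        vertices : List (Fin n)
        unique   : Unique vertices
        within   : ∀ {v} → v ∈ vertices → v ∈ S
        short    : length vertices ≤ m + m
        edgy     : m ≤ walkEdges vertices

    open Forest

    emptyForest : ∀ S → Forest 0 S
    emptyForest S = record
      { vertices = [] ; unique = [] ; within = λ () ; short = z≤n ; edgy = z≤n }

    prependEdge : ∀ {m u v S S′} → Adj G u v → Unique S → S ↭ u ∷ v ∷ S′ →
                  Forest m S′ → Forest (suc m) S
    prependEdge {m} {u} {v} {S} {S′} uv uS σ F with unique-resp-↭ σ uS
    ... | (u≢v ∷ u∉) ∷ v∉ ∷ _ = record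
      { vertices = u ∷ v ∷ vertices F
      ; unique = (u≢v ∷ All.tabulate (λ w∈ → All.lookup u∉ (within F w∈)))
                 ∷ All.tabulate (λ w∈ → All.lookup v∉ (within F w∈)) ∷ unique F
      ; within = λ w∈ → ∈-resp-↭ (↭-sym σ) (incl w∈)
      ; short = subst (2 + length (vertices F) ≤_) (eq m) (+-monoʳ-≤ 2 (short F))
      ; edgy = ≤-trans (s≤s (≤-trans (edgy F) (walkEdges-∷ v (vertices F))))
                       (walkEdges-∷∷ (vertices F) uv)
      }
      where
      incl : ∀ {w} → w ∈ u ∷ v ∷ vertices F → w ∈ u ∷ v ∷ S′
      incl (here e)          = here e
      incl (there (here e))  = there (here e)
      incl (there (there w∈)) = there (there (within F w∈))

      eq : ∀ m → 2 + (m + m) ≡ suc m + suc m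
      eq = solve-∀

    -- The forest can block at most `length (vertices F)` neighbours of `v`, so two remain as leaves
    -- of a cherry centred at `v`. Two edges are gained for one deleted vertex.
    prependCherry : ∀ {m v S S′} → Unique S → S ↭ v ∷ S′ → (F : Forest m S′) →
                    2 + length (vertices F) ≤ deg G v S′ → Forest (2 + m) S
    prependCherry {m} {v} {S} {S′} uS σ F large with unique-resp-↭ σ uS
    ... | v∉ ∷ uS′ = build free free-unique free-large (λ w∈ → w∈)
      where
      fresh? = λ w → ¬? (_∈?_ Fin._≟_ w (vertices F))
      used?  = λ w → _∈?_ Fin._≟_ w (vertices F)

      nbrs free : List (Fin n)
      nbrs = filter (adj? G v) S′
      free = filter fresh? nbrs

      free-unique : Unique free
      free-unique = Unique.filter⁺ fresh? (Unique.filter⁺ (adj? G v) uS′)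

      free-large : 2 ≤ length free
      free-large = +-cancelˡ-≤ (length (vertices F)) 2 (length free) (begin
        length (vertices F) + 2            ≡⟨ +-comm (length (vertices F)) 2 ⟩
        2 + length (vertices F)            ≤⟨ large ⟩
        length nbrs                        ≤⟨ unique-⊆⇒length≤ (Unique.filter⁺ (adj? G v) uS′) cover ⟩
        length (vertices F ++ free)        ≡⟨ length-++ (vertices F) ⟩
        length (vertices F) + length free  ∎)
        where
        open ≤-Reasoning

        cover : ∀ {w} → w ∈ nbrs → w ∈ vertices F ++ free
        cover {w} w∈ with used? w
        ... | yes w∈F = ∈-++⁺ˡ w∈F
        ... | no w∉F  = ∈-++⁺ʳ (vertices F) (∈-filter⁺ fresh? w∈ w∉F)

      eq : ∀ m → 4 + (m + m) ≡ (2 + m) + (2 + m)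
      eq = solve-∀

      build : ∀ ws → Unique ws → 2 ≤ length ws → (∀ {w} → w ∈ ws → w ∈ free) → Forest (2 + m) S
      build (_ ∷ []) _ (s≤s ()) _
      build (s ∷ t ∷ _) ((s≢t ∷ _) ∷ _) _ ⊆free
        with ∈-filter⁻ fresh? {xs = nbrs} (⊆free (here refl))
           | ∈-filter⁻ fresh? {xs = nbrs} (⊆free (there (here refl)))
      ... | s∈nbrs , s∉F | t∈nbrs , t∉F
        with ∈-filter⁻ (adj? G v) {xs = S′} s∈nbrs | ∈-filter⁻ (adj? G v) {xs = S′} t∈nbrs
      ... | s∈S′ , vs | t∈S′ , vt = record
        { vertices = s ∷ v ∷ t ∷ vertices F
        ; unique = ((λ s≡v → All.lookup v∉ s∈S′ (sym s≡v)) ∷ s≢t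
                     ∷ All.tabulate (λ w∈ s≡w → s∉F (subst (_∈ vertices F) (sym s≡w) w∈)))
                   ∷ (All.lookup v∉ t∈S′ ∷ All.tabulate (λ w∈ → All.lookup v∉ (within F w∈)))
                   ∷ All.tabulate (λ w∈ t≡w → t∉F (subst (_∈ vertices F) (sym t≡w) w∈))
                   ∷ unique F
        ; within = λ w∈ → ∈-resp-↭ (↭-sym σ) (incl w∈)
        ; short = subst (3 + length (vertices F) ≤_) (eq m)
                    (≤-trans (+-monoʳ-≤ 3 (short F)) (n≤1+n _))
        ; edgy = ≤-trans (s≤s (≤-trans (s≤s (≤-trans (edgy F) (walkEdges-∷ t (vertices F))))
                                       (walkEdges-∷∷ (vertices F) vt)))
                         (walkEdges-∷∷ (t ∷ vertices F) (adj-sym G vs))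
        }
        where
        incl : ∀ {w} → w ∈ s ∷ v ∷ t ∷ vertices F → w ∈ v ∷ S′
        incl (here refl)                 = there s∈S′
        incl (there (here e))            = here e
        incl (there (there (here refl))) = there t∈S′
        incl (there (there (there w∈)))  = there (within F w∈)

    neighbour : ∀ v S → 0 < deg G v S → ∃[ w ] w ∈ S × Adj G v w
    neighbour v S 0<deg = go (filter (adj? G v) S) 0<deg λ w∈ → ∈-filter⁻ (adj? G v) {xs = S} w∈
      where
      go : ∀ ws → 0 < length ws → (∀ {w} → w ∈ ws → w ∈ S × Adj G v w) →
           ∃[ w ] w ∈ S × Adj G v w
      go (w ∷ _) _ nbr = w , nbr (here refl)

    edge : ∀ S → 0 < edges G S → ∃[ u ] ∃[ v ] ∃[ S′ ] S ↭ u ∷ v ∷ S′ × Adj G u v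
    edge (x ∷ S) 0<e with deg G x S in eq
    ... | suc d with neighbour x S (subst (0 <_) (sym eq) z<s)
    ...   | w , w∈S , xw with remove w∈S
    ...     | S′ , σ = x , w , S′ , prep x σ , xw
    edge (x ∷ S) 0<e | zero with edge S 0<e
    ...   | u , v , S′ , σ , uv =
      u , v , x ∷ S′ , trans (prep x σ) (trans (swap x u _↭_.refl) (prep u (swap x v _↭_.refl))) , uv

    -- Deleting both ends of an edge destroys at most 2δ+1 edges.
    matching : ∀ δ s S → Unique S → (∀ {v} → v ∈ S → deg G v S ≤ suc δ) →
               s * suc (δ + δ) < edges G S + suc (δ + δ) → Forest s S
    matching δ zero S uS bounded big = emptyForest S
    matching δ (suc s) S uS bounded big
      with big′ ← +-cancelˡ-< (suc (δ + δ)) (s * suc (δ + δ)) (edges G S)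
                    (subst (suc s * suc (δ + δ) <_) (+-comm (edges G S) _) big)
      with edge S (≤-<-trans z≤n big′)
    ... | u , v , S′ , σ , uv = prependEdge uv uS σ
        (matching δ s S′ uS′ bounded′ (≤-trans big′ loss))
      where
      uS′ : Unique S′
      uS′ with unique-resp-↭ σ uS
      ... | _ ∷ _ ∷ u = u

      deg-mono : ∀ x {w} T → deg G w T ≤ deg G w (x ∷ T)
      deg-mono x {w} T with adj? G w x
      ... | yes _ = n≤1+n _
      ... | no _  = ≤-refl

      bounded-σ : ∀ {w} → w ∈ u ∷ v ∷ S′ → deg G w (u ∷ v ∷ S′) ≤ suc δ
      bounded-σ {w} w∈ = subst (_≤ suc δ) (deg-↭ G w σ) (bounded (∈-resp-↭ (↭-sym σ) w∈))

      bounded′ : ∀ {w} → w ∈ S′ → deg G w S′ ≤ suc δ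
      bounded′ w∈ = ≤-trans (deg-mono v S′) (≤-trans (deg-mono u (v ∷ S′)) (bounded-σ (there (there w∈))))

      deg-u : deg G u (v ∷ S′) ≤ suc δ
      deg-u = ≤-trans (deg-mono u (v ∷ S′)) (bounded-σ (here refl))

      deg-v : deg G v S′ ≤ δ
      deg-v = ≤-pred (begin
        suc (deg G v S′)         ≤⟨ s≤s (deg-mono v S′) ⟩
        suc (deg G v (v ∷ S′))   ≡⟨ deg-∷-adj G (v ∷ S′) (adj-sym G uv) ⟨
        deg G v (u ∷ v ∷ S′)     ≤⟨ bounded-σ (there (here refl)) ⟩
        suc δ                    ∎)
        where open ≤-Reasoning

      eq : ∀ δ e → suc δ + (δ + e) ≡ e + suc (δ + δ)
      eq = solve-∀

      loss : edges G S ≤ edges G S′ + suc (δ + δ)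
      loss = begin
        edges G S                                     ≡⟨ edges-↭ G σ ⟩
        deg G u (v ∷ S′) + (deg G v S′ + edges G S′)  ≤⟨ +-mono-≤ deg-u (+-monoˡ-≤ _ deg-v) ⟩
        suc δ + (δ + edges G S′)                      ≡⟨ eq δ (edges G S′) ⟩
        edges G S′ + suc (δ + δ)                      ∎
        where open ≤-Reasoning

    -- A vertex of degree at least `2m + 2` has two neighbours off any forest with `m` edges.
    -- Otherwise all degrees are at most `δ + 1` with `δ = 2m`, and `m + 2` disjoint edges are
    -- picked greedily; `(m + 1)(4m + 1)` is the loss from the first `m + 1` picks.
    extend : ∀ m S → Unique S → (∀ {v S′} → S ↭ v ∷ S′ → Forest m S′) →
             suc m * suc ((m + m) + (m + m)) < edges G S → Forest (2 + m) S
    extend m S uS rec big with Any.any? (λ v → 2 + (m + m) ≤? deg G v S) S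
    ... | yes high = high-case (find high)
      where
      high-case : ∃[ v ] v ∈ S × 2 + (m + m) ≤ deg G v S → Forest (2 + m) S
      high-case (v , v∈ , d) with remove v∈
      ... | S′ , σ = prependCherry uS σ (rec σ)
        (≤-trans (+-monoʳ-≤ 2 (short (rec σ)))
                 (subst (2 + (m + m) ≤_) (≡-trans (deg-↭ G v σ) (deg-∷-self G v S′)) d))
    ... | no low = matching (m + m) (2 + m) S uS
        (λ {v} v∈ → ≤-pred (≰⇒> (λ d → low (lose v∈ d))))
        (subst (_< edges G S + c) (+-comm (suc m * c) c) (+-monoˡ-< c big))
      where
      c = suc ((m + m) + (m + m))

    -- Induction on `j`: deleting any vertex leaves a graph that satisfies the hypothesis for
    -- `j - 1`, so `extend` may choose the vertex it likes.
    turan : ∀ j ε S → ε ≤ 1 → Unique S → threshold (suc j) ≤ 32 * length S →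
            j * length S + ε < edges G S + tri j → Forest (ε + suc (j + j)) S
    -- One edge is wanted and one exists; the trivial degree bound `length S` is enough for
    -- `matching`.
    turan zero zero S _ uS _ big = matching (length S) 1 S uS
      (λ {v} _ → m≤n⇒m≤1+n (length-filter (adj? G v) S))
      (subst (_< edges G S + c) (sym (+-identityʳ c))
        (+-monoˡ-< c (subst (0 <_) (+-identityʳ _) big)))
      where
      c = suc (length S + length S)
    -- Two edges always form a linear forest: they share a vertex and are a cherry, or they are
    -- disjoint.
    turan zero (suc zero) S _ uS _ big =
      extend 0 S uS (λ {v} {S′} _ → emptyForest S′) (subst (1 <_) (+-identityʳ _) big)
    turan j (suc (suc ε)) S (s≤s ()) uS _ big
    turan (suc j) ε S ε≤1 uS large big = subst (λ m → Forest m S) (m-eq ε j)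
      (extend (ε + suc (j + j)) S uS rec (many ε ε≤1 big))
      where
      open ≤-Reasoning

      m-eq : ∀ ε j → 2 + (ε + suc (j + j)) ≡ ε + suc (suc j + suc j)
      m-eq = solve-∀

      rec : ∀ {v S′} → S ↭ v ∷ S′ → Forest (ε + suc (j + j)) S′
      rec {v} {S′} σ with unique-resp-↭ σ uS
      ... | _ ∷ uS′ = turan j ε S′ ε≤1 uS′
          (lin-≤ (288 * j + 504) large′ (eq₁ j (length S′)))
          -- No slack: the edge bound drops by `length S′`, exactly the most that deleting `v` can
          -- cost.
          (lin-≤ 0 (+-mono-≤ big′ loss) (eq₂ j (length S′) ε (edges G S) (edges G S′) (tri j)))
        where
        large′ : threshold (suc (suc j)) ≤ 32 * suc (length S′)
        large′ = subst (λ l → threshold (suc (suc j)) ≤ 32 * l) (↭-length σ) large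

        big′ : suc (suc j * suc (length S′) + ε) ≤ edges G S + tri (suc j)
        big′ = subst (λ l → suc j * l + ε < edges G S + tri (suc j)) (↭-length σ) big

        loss : edges G S ≤ length S′ + edges G S′
        loss = begin
          edges G S                  ≡⟨ edges-↭ G σ ⟩
          deg G v S′ + edges G S′    ≤⟨ +-monoˡ-≤ _ (length-filter (adj? G v) S′) ⟩
          length S′ + edges G S′     ∎

        eq₁ : ∀ j l → (144 * (suc j * suc j) + 104 * suc j + 49) + 32 * suc l + (288 * j + 504)
              ≡ 32 * l + (144 * (suc (suc j) * suc (suc j)) + 104 * suc (suc j) + 49)
        eq₁ = solve-∀

        eq₂ : ∀ j l ε e e′ t → suc (j * l + ε) + ((e + (suc j + t)) + (l + e′)) + 0
              ≡ (e′ + t) + (suc (suc j * suc l + ε) + e)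
        eq₂ = solve-∀

      l = length S
      e = edges G S

      -- The target is quadratic in `j`, whereas `e` is about `(j + 1) l`, which `threshold` makes
      -- cubic. The factor 64 turns `l` into multiples of `32 * l` and `tri` into multiples of
      -- `tri + tri`.
      many : ∀ ε → ε ≤ 1 → suc j * l + ε < e + tri (suc j) →
             suc (ε + suc (j + j)) *
               suc ((ε + suc (j + j)) + (ε + suc (j + j)) + ((ε + suc (j + j)) + (ε + suc (j + j)))) < e
      many zero _ big = *-cancelˡ-< 64 _ e (lin-≤
        (288 * (j * j * j) + 592 * (j * j) + 1266 * j + 1025)
        (+-mono-≤ (*-monoʳ-≤ 64 big)
          (+-mono-≤ (*-monoʳ-≤ (2 * suc j) large) (*-monoʳ-≤ 32 (≤-reflexive (tri+tri (suc j))))))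
        (eq j l e (tri j)))
        where
        eq : ∀ j l e t →
             suc (64 * (suc (suc (j + j)) * suc (suc (j + j) + suc (j + j) + (suc (j + j) + suc (j + j)))))
             + (64 * (e + (suc j + t)) + ((2 * suc j) * (32 * l) + 32 * (suc j * suc (suc j))))
             + (288 * (j * j * j) + 592 * (j * j) + 1266 * j + 1025)
             ≡ 64 * e + (64 * suc (suc j * l + 0)
               + ((2 * suc j) * (144 * (suc (suc j) * suc (suc j)) + 104 * suc (suc j) + 49)
               + 32 * ((suc j + t) + (suc j + t))))
        eq = solve-∀
      -- At `j = 0`, that is `k = 2`, the slack is 1 after scaling by 64, so the bound on `n` is
      -- nearly exhausted there; it then grows cubically.
      many (suc zero) _ big = *-cancelˡ-< 64 _ e (lin-≤
        (288 * (j * j * j) + 592 * (j * j) + 242 * j + 1)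
        (+-mono-≤ (*-monoʳ-≤ 64 big)
          (+-mono-≤ (*-monoʳ-≤ (2 * suc j) large) (*-monoʳ-≤ 32 (≤-reflexive (tri+tri (suc j))))))
        (eq j l e (tri j)))
        where
        eq : ∀ j l e t →
             suc (64 * (suc (suc (suc (j + j))) * suc (suc (suc (j + j)) + suc (suc (j + j))
               + (suc (suc (j + j)) + suc (suc (j + j))))))
             + (64 * (e + (suc j + t)) + ((2 * suc j) * (32 * l) + 32 * (suc j * suc (suc j))))
             + (288 * (j * j * j) + 592 * (j * j) + 242 * j + 1)
             ≡ 64 * e + (64 * suc (suc j * l + 1)
               + ((2 * suc j) * (144 * (suc (suc j) * suc (suc j)) + 104 * suc (suc j) + 49)
               + 32 * ((suc j + t) + (suc j + t))))
        eq = solve-∀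
      many (suc (suc _)) (s≤s ())

  -- Sliding windows

  -- Lookup is total, with a default past the end, so that shifting a window is plain addition of
  -- indices.
  at : A → List A → ℕ → A
  at d []       i       = d
  at d (x ∷ xs) zero    = x
  at d (x ∷ xs) (suc i) = at d xs i

  module _ (d : A) where

    at-∈ : ∀ xs {i} → i < length xs → at d xs i ∈ xs
    at-∈ (x ∷ xs) {zero}  _         = here refl
    at-∈ (x ∷ xs) {suc i} (s≤s i<l) = there (at-∈ xs i<l)

    at-injective : ∀ {i j} → Unique xs → i < j → j < length xs → at d xs i ≢ at d xs j
    at-injective {xs = x ∷ xs} {zero}  {suc j} (x∉ ∷ _) _ (s≤s j<l) = All.lookup x∉ (at-∈ xs j<l)
    at-injective {xs = x ∷ xs} {suc i} {suc j} (_ ∷ u) (s≤s i<j) (s≤s j<l) = at-injective u i<j j<l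

    at-++ˡ : ∀ xs ys {i} → i < length xs → at d (xs ++ ys) i ≡ at d xs i
    at-++ˡ (x ∷ xs) ys {zero}  _         = refl
    at-++ˡ (x ∷ xs) ys {suc i} (s≤s i<l) = at-++ˡ xs ys i<l

    at-++ʳ : ∀ xs ys j → at d (xs ++ ys) (length xs + j) ≡ at d ys j
    at-++ʳ []       ys j = refl
    at-++ʳ (x ∷ xs) ys j = at-++ʳ xs ys j

  _≟ᶜ_ : (c d : Color) → Dec (c ≡ d)
  red  ≟ᶜ red  = yes refl
  red  ≟ᶜ blue = no λ ()
  blue ≟ᶜ red  = no λ ()
  blue ≟ᶜ blue = yes refl

  count : Color → (ℕ → Color) → ℕ → ℕ
  count κ c zero    = 0
  count κ c (suc l) = indicator (c 0 ≟ᶜ κ) + count κ (c ∘ suc) l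

  indicator≤1 : {P : Set p} (P? : Dec P) → indicator P? ≤ 1
  indicator≤1 (yes _) = ≤-refl
  indicator≤1 (no _)  = z≤n

  count-cong : ∀ κ {c c′ : ℕ → Color} → (∀ i → c i ≡ c′ i) → ∀ l → count κ c l ≡ count κ c′ l
  count-cong κ c≗c′ zero    = refl
  count-cong κ c≗c′ (suc l) rewrite c≗c′ 0 = cong (_ +_) (count-cong κ (λ i → c≗c′ (suc i)) l)

  count-grow : ∀ κ c l → count κ c l ≤ count κ c (suc l)
  count-grow κ c zero    = z≤n
  count-grow κ c (suc l) = +-monoʳ-≤ (indicator (c 0 ≟ᶜ κ)) (count-grow κ (c ∘ suc) l)

  count-red+blue : ∀ c l → count red c l + count blue c l ≡ l
  count-red+blue c zero = refl
  count-red+blue c (suc l) with c 0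
  ... | red  = cong suc (count-red+blue (c ∘ suc) l)
  ... | blue = ≡-trans (+-suc _ _) (cong suc (count-red+blue (c ∘ suc) l))

  count-step : ∀ κ c l i → count κ (λ j → c (i + j)) l ≤ suc (count κ (λ j → c (suc i + j)) l)
  count-step κ c l i = begin
    count κ (λ j → c (i + j)) l            ≤⟨ count-grow κ (λ j → c (i + j)) l ⟩
    count κ (λ j → c (i + j)) (suc l)      ≤⟨ +-monoˡ-≤ _ (indicator≤1 (c (i + 0) ≟ᶜ κ)) ⟩
    suc (count κ (λ j → c (i + suc j)) l)
      ≡⟨ cong suc (count-cong κ (λ j → cong c (+-suc i j)) l) ⟩
    suc (count κ (λ j → c (suc i + j)) l)  ∎
    where open ≤-Reasoning

  -- Only drops are limited to one. Upward jumps are harmless, since `f` stays at or above `m` until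
  -- it first equals `m`.
  discrete-ivt : ∀ (f : ℕ → ℕ) m L → (∀ i → f i ≤ suc (f (suc i))) → m ≤ f 0 → f L ≤ m →
                 ∃[ i ] i ≤ L × f i ≡ m
  discrete-ivt f m zero step lo hi = 0 , z≤n , ≤-antisym hi lo
  discrete-ivt f m (suc L) step lo hi with m ≟ f 0
  ... | yes m≡f0 = 0 , z≤n , sym m≡f0
  ... | no m≢f0 with discrete-ivt (f ∘ suc) m L (step ∘ suc)
                       (≤-pred (≤-trans (≤∧≢⇒< lo m≢f0) (step 0))) hi
  ...   | i , i≤L , eq = suc i , s≤s i≤L , eq

  module Sliding (R B : Graph n) (total : ∀ {u v} → u ≢ v → Adj R u v ⊎ Adj B u v) where

    -- The colour is data because an edge may lie in both `R` and `B`. Nothing is asked of `vertex`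
    -- beyond index `d` or of `colour` from index `d` on.
    record ColouredPath (d m : ℕ) : Set where
      field
        vertex    : ℕ → Fin n
        distinct  : ∀ {i j} → i < j → j ≤ d → vertex i ≢ vertex j
        colour    : ℕ → Color
        red-edge  : ∀ {i} → i < d → colour i ≡ red → Adj R (vertex i) (vertex (suc i))
        blue-edge : ∀ {i} → i < d → colour i ≡ blue → Adj B (vertex i) (vertex (suc i))
        red-count : count red colour d ≡ m

    -- These break the tie on edges lying in both classes: towards red where many red edges are
    -- wanted, towards blue where few are.
    preferRed preferBlue : Fin n → Fin n → Color
    preferRed u v with adj? R u v
    ... | yes _ = red
    ... | no _  = blue
    preferBlue u v with adj? B u v
    ... | yes _ = blue
    ... | no _  = red

    Admissible : Color → Fin n → Fin n → Set
    Admissible red  = Adj R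
    Admissible blue = Adj B

    preferRed-admissible : ∀ {u v} → u ≢ v → Admissible (preferRed u v) u v
    preferRed-admissible {u} {v} u≢v with adj? R u v | total u≢v
    ... | yes uv | _       = uv
    ... | no ¬uv | inj₁ uv = ⊥-elim (¬uv uv)
    ... | no _   | inj₂ uv = uv

    preferBlue-admissible : ∀ {u v} → u ≢ v → Admissible (preferBlue u v) u v
    preferBlue-admissible {u} {v} u≢v with adj? B u v | total u≢v
    ... | yes uv | _       = uv
    ... | no _   | inj₁ uv = uv
    ... | no ¬uv | inj₂ uv = ⊥-elim (¬uv uv)

    count-preferRed : ∀ z c d xs → length xs ≡ suc d →
                      (∀ i → i < d → c i ≡ preferRed (at z xs i) (at z xs (suc i))) →
                      walkEdges R xs ≤ count red c d
    count-preferRed z c zero (x ∷ []) _ _ = z≤n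
    count-preferRed z c (suc d) (x ∷ y ∷ xs) len c≡ with c 0 | c≡ 0 z<s
    ... | _ | refl with adj? R x y
    ...   | yes _ = s≤s (count-preferRed z (c ∘ suc) d (y ∷ xs) (suc-injective len)
                           (λ i i<d → c≡ (suc i) (s≤s i<d)))
    ...   | no _  = count-preferRed z (c ∘ suc) d (y ∷ xs) (suc-injective len)
                      (λ i i<d → c≡ (suc i) (s≤s i<d))

    count-preferBlue : ∀ z c d xs → length xs ≡ suc d →
                       (∀ i → i < d → c i ≡ preferBlue (at z xs i) (at z xs (suc i))) →
                       count red c d + walkEdges B xs ≤ d
    count-preferBlue z c zero (x ∷ []) _ _ = z≤n
    count-preferBlue z c (suc d) (x ∷ y ∷ xs) len c≡ with c 0 | c≡ 0 z<s
    ... | _ | refl with adj? B x y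
                      | count-preferBlue z (c ∘ suc) d (y ∷ xs) (suc-injective len)
                          (λ i i<d → c≡ (suc i) (s≤s i<d))
    ...   | yes _ | ih = subst (_≤ suc d) (sym (+-suc _ _)) (s≤s ih)
    ...   | no _  | ih = s≤s ih

    walkEdges-total : ∀ d xs → length xs ≡ suc d → Unique xs → d ≤ walkEdges R xs + walkEdges B xs
    walkEdges-total zero xs _ _ = z≤n
    walkEdges-total (suc d) (x ∷ y ∷ xs) len ((x≢y ∷ _) ∷ u)
      with walkEdges-total d (y ∷ xs) (suc-injective len) u | adj? R x y | adj? B x y | total x≢y
    ... | ih | yes _  | yes _  | _ = s≤s (≤-trans ih (+-monoʳ-≤ _ (n≤1+n _)))
    ... | ih | yes _  | no _   | _ = s≤s ih
    ... | ih | no _   | yes _  | _ = subst (suc d ≤_) (sym (+-suc _ _)) (s≤s ih)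
    ... | _  | no ¬xy | no _   | inj₁ xy = ⊥-elim (¬xy xy)
    ... | _  | no _   | no ¬xy | inj₂ xy = ⊥-elim (¬xy xy)

    -- Along the walk xs ++ ys the number of red edges in a window of length d = 2m changes
    -- by at most one at each step; it starts at ≥ m (edges of xs are red whenever possible)
    -- and ends at ≤ m (all later edges are blue whenever possible).
    slide : ∀ z m xs ys → let d = m + m in
            length xs ≡ suc d → length ys ≡ suc d → Unique xs → Unique ys →
            (∀ {i j} → j < i → i ≤ d → at z ys j ≢ at z xs i) →
            m ≤ walkEdges R xs → m ≤ walkEdges B ys → ColouredPath d m
    slide z m xs ys lx ly ux uy crossing redx bluey =
      window (discrete-ivt (λ i → count red (λ j → c (i + j)) span) m (suc span)
               (count-step red c span) start end)
      where
      span = m + m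

      w : ℕ → Fin n
      w = at z (xs ++ ys)

      c : ℕ → Color
      -- Index `span` is the edge from the last vertex of `xs` to the first of `ys`; it already
      -- prefers blue, as do all edges of the final window.
      c i with i <? span
      ... | yes _ = preferRed (w i) (w (suc i))
      ... | no _  = preferBlue (w i) (w (suc i))

      c-early : ∀ {i} → i < span → c i ≡ preferRed (w i) (w (suc i))
      c-early {i} i<d with i <? span
      ... | yes _  = refl
      ... | no i≮d = ⊥-elim (i≮d i<d)

      c-late : ∀ {i} → span ≤ i → c i ≡ preferBlue (w i) (w (suc i))
      c-late {i} d≤i with i <? span
      ... | yes i<d = ⊥-elim (≤⇒≯ d≤i i<d)
      ... | no _    = refl

      w-left : ∀ {i} → i ≤ span → w i ≡ at z xs i
      w-left i≤d = at-++ˡ z xs ys (subst (_ <_) (sym lx) (s≤s i≤d))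

      w-right : ∀ j → w (suc span + j) ≡ at z ys j
      w-right j = ≡-trans (cong (λ l → w (l + j)) (sym lx)) (at-++ʳ z xs ys j)

      c-admissible : ∀ i → w i ≢ w (suc i) → Admissible (c i) (w i) (w (suc i))
      c-admissible i ≢ with i <? span
      ... | yes _ = preferRed-admissible ≢
      ... | no _  = preferBlue-admissible ≢

      start : m ≤ count red c span
      start = ≤-trans redx (count-preferRed z c span xs lx λ i i<d →
        ≡-trans (c-early i<d) (cong₂ preferRed (w-left (<⇒≤ i<d)) (w-left i<d)))

      end : count red (λ j → c (suc span + j)) span ≤ m
      end = +-cancelʳ-≤ m _ m (≤-trans (+-monoʳ-≤ _ bluey)
        (count-preferBlue z (λ j → c (suc span + j)) span ys ly λ i i<d →
          ≡-trans (c-late (≤-trans (n≤1+n span) (m≤m+n (suc span) i)))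
            (cong₂ preferBlue (w-right i) (≡-trans (cong w (sym (+-suc (suc span) i))) (w-right (suc i))))))

      beyond : ∀ {i} → ¬ (i ≤ span) → ∃[ i′ ] i ≡ suc span + i′
      beyond {i} i≰d = i ∸ suc span , sym (m+[n∸m]≡n (≰⇒> i≰d))

      w-distinct : ∀ {i j} → i < j → j ≤ i + span → j ≤ suc span + span → w i ≢ w j
      w-distinct {i} {j} i<j j≤i+d j≤end with j ≤? span
      ... | yes j≤d = λ eq → at-injective z ux i<j (subst (j <_) (sym lx) (s≤s j≤d))
                        (≡-trans (sym (w-left (≤-trans (<⇒≤ i<j) j≤d))) (≡-trans eq (w-left j≤d)))
      ... | no j≰d with beyond j≰d
      ...   | j′ , refl with i ≤? span
      -- A window holding both `i` and `suc span + j′` has `suc span + j′ ≤ i + span`, hence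
      -- `j′ < i`: the range covered by `crossing`.
      ...     | yes i≤d = λ eq → crossing (+-cancelʳ-≤ span (suc j′) i
                                   (subst (_≤ i + span) (cong suc (+-comm span j′)) j≤i+d)) i≤d
                            (≡-trans (sym (w-right j′)) (≡-trans (sym eq) (w-left i≤d)))
      ...     | no i≰d with beyond i≰d
      ...       | i′ , refl = λ eq → at-injective z uy (+-cancelˡ-< (suc span) i′ j′ i<j)
                                (subst (j′ <_) (sym ly) (s≤s (+-cancelˡ-≤ (suc span) j′ span j≤end)))
                                (≡-trans (sym (w-right i′)) (≡-trans eq (w-right j′)))

      window : (∃[ i ] i ≤ suc span × count red (λ j → c (i + j)) span ≡ m) → ColouredPath span m
      window (i , i≤N , eq) = record
        { vertex    = λ j → w (i + j)
        ; distinct  = apart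
        ; colour    = λ j → c (i + j)
        ; red-edge  = λ {j} j<d → edge-of j j<d red
        ; blue-edge = λ {j} j<d → edge-of j j<d blue
        ; red-count = eq
        }
        where
        apart : ∀ {j k} → j < k → k ≤ span → w (i + j) ≢ w (i + k)
        apart {j} {k} j<k k≤d = w-distinct (+-monoʳ-< i j<k)
          (≤-trans (+-monoʳ-≤ i k≤d) (+-monoˡ-≤ span (m≤m+n i j))) (+-mono-≤ i≤N k≤d)

        edge-of : ∀ j → j < span → ∀ κ → c (i + j) ≡ κ → Admissible κ (w (i + j)) (w (i + suc j))
        edge-of j j<d κ refl = subst (Admissible (c (i + j)) (w (i + j)) ∘ w) (sym (+-suc i j))
          (c-admissible (i + j)
            (subst (λ l → w (i + j) ≢ w l) (+-suc i j) (apart (n<1+n j) j<d)))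

  -- Linking two overlapping paths through a third

  length-filter-¬ : {A : Set a} {P : A → Set p} (P? : ∀ x → Dec (P x)) → ∀ xs →
                    length (filter P? xs) + length (filter (¬? ∘ P?) xs) ≡ length xs
  length-filter-¬ P? [] = refl
  length-filter-¬ P? (x ∷ xs) with P? x
  ... | yes _ = cong suc (length-filter-¬ P? xs)
  ... | no _  = ≡-trans (+-suc _ _) (cong suc (length-filter-¬ P? xs))

  length-allFin : ∀ n → length (allFin n) ≡ n
  length-allFin n = length-tabulate {n = n} id

  private
    mem : (v : Fin n) (xs : List (Fin n)) → Dec (v ∈ xs)
    mem = _∈?_ Fin._≟_

  outside : List (Fin n) → List (Fin n)
  outside {n} xs = filter (λ v → ¬? (mem v xs)) (allFin n)

  unique-outside : (xs : List (Fin n)) → Unique (outside xs)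
  unique-outside {n} xs = Unique.filter⁺ (λ v → ¬? (mem v xs)) (Unique.allFin⁺ n)

  ∈-outside : (xs : List (Fin n)) → ∀ {v} → v ∈ outside xs → v ∉ xs
  ∈-outside {n} xs v∈ = proj₂ (∈-filter⁻ (λ v → ¬? (mem v xs)) {xs = allFin n} v∈)

  length-outside : (xs : List (Fin n)) → n ≤ length xs + length (outside xs)
  length-outside {n} xs = begin
    n                                ≡⟨ length-allFin n ⟨
    length (allFin n)                ≤⟨ unique-⊆⇒length≤ (Unique.allFin⁺ n) (λ {v} _ → cover v) ⟩
    length (xs ++ outside xs)        ≡⟨ length-++ xs ⟩
    length xs + length (outside xs)  ∎
    where
    open ≤-Reasoning

    cover : ∀ v → v ∈ xs ++ outside xs
    cover v with mem v xs
    ... | yes v∈ = ∈-++⁺ˡ v∈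
    ... | no v∉  = ∈-++⁺ʳ xs (∈-filter⁺ (λ v → ¬? (mem v xs)) (∈-allFin v) v∉)

  pad : (G : Graph n) → ∀ k xs → Unique xs → k + length xs ≤ n →
        ∃[ ys ] Unique ys × length ys ≡ k + length xs × walkEdges G xs ≤ walkEdges G ys
  pad G zero xs u _ = xs , u , refl , ≤-refl
  pad {n} G (suc k) xs u room with pad G k xs u (≤-trans (n≤1+n _) room)
  ... | ys , uy , ly , more = prepend (outside ys) (∈-outside ys) (+-cancelˡ-≤ (length ys) 1 _ (begin
          length ys + 1                    ≡⟨ +-comm (length ys) 1 ⟩
          suc (length ys)                  ≡⟨ cong suc ly ⟩
          suc k + length xs                ≤⟨ room ⟩
          n                                ≤⟨ length-outside ys ⟩
          length ys + length (outside ys)  ∎))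
    where
    open ≤-Reasoning

    prepend : ∀ vs → (∀ {v} → v ∈ vs → v ∉ ys) → 1 ≤ length vs →
              ∃[ zs ] Unique zs × length zs ≡ suc k + length xs × walkEdges G xs ≤ walkEdges G zs
    prepend (v ∷ _) fresh _ =
      v ∷ ys
      , All.tabulate (λ w∈ v≡w → fresh (here refl) (subst (_∈ ys) (sym v≡w) w∈)) ∷ uy
      , cong suc ly , ≤-trans more (walkEdges-∷ G v ys)

  module _ (ps : List (Fin n)) where

    -- Entries of `qs` lying in `ps` are replaced by fresh vertices and all others keep their
    -- position, which is what `aligned` needs later. When the fresh vertices run out, entries stay
    -- as they are, so `mix-avoids` asks for enough of them.
    mix : List (Fin n) → List (Fin n) → List (Fin n)
    mix []       fs       = []
    mix (q ∷ qs) []       = q ∷ mix qs []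
    mix (q ∷ qs) (f ∷ fs) with mem q ps
    ... | yes _ = f ∷ mix qs fs
    ... | no _  = q ∷ mix qs (f ∷ fs)

    length-mix : ∀ qs fs → length (mix qs fs) ≡ length qs
    length-mix []       fs       = refl
    length-mix (q ∷ qs) []       = cong suc (length-mix qs [])
    length-mix (q ∷ qs) (f ∷ fs) with mem q ps
    ... | yes _ = cong suc (length-mix qs fs)
    ... | no _  = cong suc (length-mix qs (f ∷ fs))

    mix-⊆ : ∀ qs fs {v} → v ∈ mix qs fs → v ∈ qs ⊎ v ∈ fs
    mix-⊆ (q ∷ qs) [] (here e)   = inj₁ (here e)
    mix-⊆ (q ∷ qs) [] (there v∈) = Sum.map there id (mix-⊆ qs [] v∈)
    mix-⊆ (q ∷ qs) (f ∷ fs) v∈ with mem q ps | v∈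
    ... | yes _ | here e   = inj₂ (here e)
    ... | yes _ | there v∈ = Sum.map there there (mix-⊆ qs fs v∈)
    ... | no _  | here e   = inj₁ (here e)
    ... | no _  | there v∈ = Sum.map there id (mix-⊆ qs (f ∷ fs) v∈)

    mix-unique : ∀ qs fs → Unique qs → Unique fs → (∀ {v} → v ∈ fs → v ∉ qs) → Unique (mix qs fs)
    mix-unique []       fs _ _ _ = []
    mix-unique (q ∷ qs) [] (q∉ ∷ uq) uf fs∌ =
      All.tabulate (λ v∈ → Sum.[ All.lookup q∉ , (λ ()) ] (mix-⊆ qs [] v∈))
      ∷ mix-unique qs [] uq uf (λ ())
    mix-unique (q ∷ qs) (f ∷ fs) (q∉ ∷ uq) uf@(f∉ ∷ uf′) fs∌ with mem q ps
    ... | yes _ =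
      All.tabulate (λ v∈ → Sum.[ (λ v∈qs f≡v → fs∌ (here refl) (there (subst (_∈ qs) (sym f≡v) v∈qs)))
                               , All.lookup f∉ ] (mix-⊆ qs fs v∈))
      ∷ mix-unique qs fs uq uf′ (λ v∈ v∈qs → fs∌ (there v∈) (there v∈qs))
    ... | no _ =
      All.tabulate (λ v∈ → Sum.[ All.lookup q∉
                               , (λ v∈fs q≡v → fs∌ v∈fs (here (sym q≡v))) ] (mix-⊆ qs (f ∷ fs) v∈))
      ∷ mix-unique qs (f ∷ fs) uq uf (λ v∈ v∈qs → fs∌ v∈ (there v∈qs))

    mix-avoids : ∀ qs fs → (∀ {v} → v ∈ fs → v ∉ ps) →
                 length (filter (λ v → mem v ps) qs) ≤ length fs → ∀ {v} → v ∈ mix qs fs → v ∉ ps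
    mix-avoids (q ∷ qs) [] fs∌ room v∈ with mem q ps | v∈
    ... | no q∉ | here refl = q∉
    ... | no _  | there v∈  = mix-avoids qs [] fs∌ room v∈
    mix-avoids (q ∷ qs) (f ∷ fs) fs∌ room v∈ with mem q ps | v∈
    ... | yes _ | here refl = fs∌ (here refl)
    ... | yes _ | there v∈  = mix-avoids qs fs (fs∌ ∘ there) (≤-pred room) v∈
    ... | no q∉ | here refl = q∉
    ... | no _  | there v∈  = mix-avoids qs (f ∷ fs) fs∌ room v∈

    mix-aligned : ∀ z qs fs i → i < length qs →
                  at z (mix qs fs) i ≡ at z qs i ⊎ at z (mix qs fs) i ∈ fs
    mix-aligned z (q ∷ qs) []       zero    _         = inj₁ refl
    mix-aligned z (q ∷ qs) []       (suc i) (s≤s i<l) = mix-aligned z qs [] i i<l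
    mix-aligned z (q ∷ qs) (f ∷ fs) i       i<l with mem q ps | i | i<l
    ... | yes _ | zero  | _       = inj₂ (here refl)
    ... | yes _ | suc i | s≤s i<l = Sum.map id there (mix-aligned z qs fs i i<l)
    ... | no _  | zero  | _       = inj₁ refl
    ... | no _  | suc i | s≤s i<l = mix-aligned z qs (f ∷ fs) i i<l

  module Balancing (R B : Graph n) (total : ∀ {u v} → u ≢ v → Adj R u v ⊎ Adj B u v) where

    open Sliding R B total public

    module Link (m : ℕ) (z : Fin n) (ps qs : List (Fin n)) (room : suc (m + m) + suc (m + m) ≤ n)
                (lp : length ps ≡ suc (m + m)) (lq : length qs ≡ suc (m + m))
                (up : Unique ps) (uq : Unique qs) where

      rest = filter (λ v → ¬? (mem v ps)) qs
      fs   = outside (ps ++ rest)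
      ts   = mix ps qs fs

      fs∌ps : ∀ {v} → v ∈ fs → v ∉ ps
      fs∌ps v∈ v∈ps = ∈-outside (ps ++ rest) v∈ (∈-++⁺ˡ v∈ps)

      fs∌qs : ∀ {v} → v ∈ fs → v ∉ qs
      fs∌qs v∈ v∈qs = ∈-outside (ps ++ rest) v∈
        (∈-++⁺ʳ ps (∈-filter⁺ (λ v → ¬? (mem v ps)) v∈qs (fs∌ps v∈)))

      lt : length ts ≡ suc (m + m)
      lt = ≡-trans (length-mix ps qs fs) lq

      ut : Unique ts
      ut = mix-unique ps qs fs uq (unique-outside (ps ++ rest)) fs∌qs

      -- `ps` and `rest` together list the union of `ps` and `qs`. Since `n` is at least the sum of
      -- both lengths, the vertices outside the union are at least as many as the shared ones.
      enough : length (filter (λ v → mem v ps) qs) ≤ length fs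
      enough = lin-≤ 0 room′ (eq (length ps) (length (filter (λ v → mem v ps) qs))
                               (length rest) (length fs))
        where
        open ≤-Reasoning

        eq : ∀ p s r f → s + ((p + r) + f) + 0 ≡ f + (p + (s + r))
        eq = solve-∀

        room′ : length ps + (length (filter (λ v → mem v ps) qs) + length rest)
                ≤ length ps + length rest + length fs
        room′ = begin
          length ps + (length (filter (λ v → mem v ps) qs) + length rest)
            ≡⟨ cong₂ _+_ lp (≡-trans (length-filter-¬ (λ v → mem v ps) qs) lq) ⟩
          suc (m + m) + suc (m + m)          ≤⟨ room ⟩
          n                                  ≤⟨ length-outside (ps ++ rest) ⟩
          length (ps ++ rest) + length fs    ≡⟨ cong (_+ length fs) (length-++ ps) ⟩
          length ps + length rest + length fs ∎

      -- Entry `i` of `ts` is either entry `i` of `qs`, which differs from the earlier entry `j`, or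
      -- fresh and so not in `qs` at all.
      aligned : ∀ {i j} → j < i → i ≤ m + m → at z qs j ≢ at z ts i
      aligned {i} {j} j<i i≤d eq
        with mix-aligned ps z qs fs i (subst (i <_) (sym lq) (s≤s i≤d))
      ... | inj₁ same  = at-injective z uq j<i (subst (i <_) (sym lq) (s≤s i≤d)) (≡-trans eq same)
      ... | inj₂ fresh = fs∌qs fresh (subst (_∈ qs) eq
                           (at-∈ z qs (subst (j <_) (sym lq) (<-trans j<i (s≤s i≤d)))))

      disjoint : ∀ {i j} → j < i → i ≤ m + m → at z ts j ≢ at z ps i
      disjoint {i} {j} j<i i≤d eq = mix-avoids ps qs fs fs∌ps enough
        (at-∈ z ts (subst (j <_) (sym lt) (<-trans j<i (s≤s i≤d))))
        (subst (_∈ ps) (sym eq) (at-∈ z ps (subst (i <_) (sym lp) (s≤s i≤d))))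

    -- Two heavy paths are linked through a third one ts, disjoint from ps, which carries every
    -- vertex shared with qs at the same position as qs; so both ps ++ ts and ts ++ qs have
    -- repetition-free windows.
    link : ∀ m ps qs → let d = m + m in suc d + suc d ≤ n →
           length ps ≡ suc d → length qs ≡ suc d → Unique ps → Unique qs →
           m ≤ walkEdges R ps → m ≤ walkEdges B qs → ColouredPath d m
    link m [] qs _ () _ _ _ _ _
    link m ps@(z ∷ _) qs room lp lq up uq redp blueq with m ≤? walkEdges R (mix ps qs fs)
      where
      fs = outside (ps ++ filter (λ v → ¬? (mem v ps)) qs)
    -- Of the `2m` edges of `ts`, at least `m` are red or at least `m` are blue, so `ts` can stand
    -- in for `ps` or for `qs`.
    ... | yes redt = slide z m ts qs lt lq ut uq aligned redt blueq
      where open Link m z ps qs room lp lq up uq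
    ... | no ¬redt = slide z m ps ts lp lt up ut disjoint redp (+-cancelˡ-≤ m m _
        (≤-trans (walkEdges-total (m + m) ts lt ut) (+-monoˡ-≤ _ (≰⇒≥ ¬redt))))
      where open Link m z ps qs room lp lq up uq

    balanced-path : ∀ m → suc (m + m) + suc (m + m) ≤ n →
                    Forest R m (allFin n) → Forest B m (allFin n) → ColouredPath (m + m) m
    balanced-path m room F H with heavy R F | heavy B H
      where
      open Forest
      heavy : (G : Graph n) → Forest G m (allFin n) →
              ∃[ ps ] Unique ps × length ps ≡ suc (m + m) × m ≤ walkEdges G ps
      heavy G F with pad G (suc (m + m) ∸ length (vertices F)) (vertices F) (unique F)
                       (subst (_≤ n) (sym (m∸n+n≡m (m≤n⇒m≤1+n (short F))))
                         (≤-trans (m≤m+n (suc (m + m)) _) room))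
      ... | ps , u , l , more = ps , u , ≡-trans l (m∸n+n≡m (m≤n⇒m≤1+n (short F))) , ≤-trans (edgy F) more
    ... | ps , up , lp , redp | qs , uq , lq , blueq = link m ps qs room lp lq up uq redp blueq

  -- Balanced copies of paths and cycles

  -- The only possible neighbour of the first vertex among the later ones is the second, so peeling
  -- it off adds one indicator.
  edges-path : (H : Graph n) (κ : Color) (c : ℕ → Color) (f : Fin (suc d) → Fin n) →
               (∀ {i j} → toℕ i < toℕ j → Adj H (f i) (f j) → suc (toℕ i) ≡ toℕ j) →
               (∀ i → Adj H (f (inject₁ i)) (f (suc i)) → c (toℕ i) ≡ κ) →
               (∀ i → c (toℕ i) ≡ κ → Adj H (f (inject₁ i)) (f (suc i))) →
               edges H (tabulate f) ≡ count κ c d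
  edges-path {d = zero} H κ c f consecutive to from = refl
  edges-path {d = suc d} H κ c f consecutive to from = cong₂ _+_ first
    (edges-path H κ (c ∘ suc) (f ∘ suc) (λ i<j adj → suc-injective (consecutive (s≤s i<j) adj))
       (to ∘ suc) (from ∘ suc))
    where
    far : ∀ (j : Fin d) → ¬ Adj H (f zero) (f (suc (suc j)))
    far j adj with consecutive z<s adj
    ... | ()

    rest : deg H (f zero) (tabulate (λ j → f (suc (suc j)))) ≡ 0
    rest = cong length (filter-none (adj? H (f zero)) (AllP.tabulate⁺ far))

    first : deg H (f zero) (tabulate (λ j → f (suc j))) ≡ indicator (c 0 ≟ᶜ κ)
    first with c 0 ≟ᶜ κ
    ... | yes c≡ = ≡-trans (deg-∷-adj H _ (from zero c≡)) (cong suc rest)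
    ... | no c≢  = ≡-trans (deg-∷-¬adj H _ (c≢ ∘ to zero)) rest

  colourPart : (G : Graph n) (col : Fin n → Fin n → Color) → (∀ u v → col u v ≡ col v u) →
               Color → Graph n
  colourPart G col col-sym κ = record
    { Adj        = λ u v → Adj G u v × col u v ≡ κ
    ; adj?       = λ u v → adj? G u v ×-dec (col u v ≟ᶜ κ)
    ; adj-sym    = λ {u} {v} (uv , c≡) → adj-sym G uv , ≡-trans (col-sym v u) c≡
    ; adj-irrefl = λ u≡v (uv , _) → adj-irrefl G u≡v uv
    }

  colourPartition : (G : Graph n) (col : Fin n → Fin n → Color) → (∀ u v → col u v ≡ col v u) →
                    Partition G
  colourPartition G col col-sym = record
    { E₁       = colourPart G col col-sym red
    ; E₂       = colourPart G col col-sym blue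
    ; E₁⊆G     = proj₁
    ; E₂⊆G     = proj₁
    ; covers   = λ {u} {v} uv → cover u v uv
    ; disjoint = λ (_ , r) (_ , b) → red≢blue (≡-trans (sym r) b)
    }
    where
    red≢blue : red ≢ blue
    red≢blue ()

    cover : ∀ u v → Adj G u v → (Adj G u v × col u v ≡ red) ⊎ (Adj G u v × col u v ≡ blue)
    cover u v uv with col u v
    ... | red  = inj₁ (uv , refl)
    ... | blue = inj₂ (uv , refl)

  -- The path edge between `i` and `i + 1` gets colour `c i`; taking the minimum makes this
  -- symmetric.
  minColour : (ℕ → Color) → Fin n → Fin n → Color
  minColour c u v = c (toℕ u ⊓ toℕ v)

  minColour-sym : ∀ c (u v : Fin n) → minColour c u v ≡ minColour c v u
  minColour-sym c u v = cong c (⊓-comm (toℕ u) (toℕ v))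

  size-pathPart : ∀ d κ c → size (colourPart (P d) (minColour c) (minColour-sym c) κ) ≡ count κ c d
  size-pathPart d κ c = ≡-trans (size≡edges H) (edges-path H κ c id consecutive to from)
    where
    H = colourPart (P d) (minColour c) (minColour-sym c) κ

    consecutive : ∀ {i j} → toℕ i < toℕ j → Adj H i j → suc (toℕ i) ≡ toℕ j
    consecutive i<j (inj₁ eq , _) = eq
    consecutive i<j (inj₂ eq , _) = ⊥-elim (<-asym i<j (≤-reflexive eq))

    min : ∀ (i : Fin d) → toℕ (inject₁ i) ⊓ toℕ (suc i) ≡ toℕ i
    min i rewrite Fin.toℕ-inject₁ i = m≤n⇒m⊓n≡m (n≤1+n _)

    to : ∀ i → Adj H (inject₁ i) (suc i) → c (toℕ i) ≡ κ
    to i (_ , eq) = ≡-trans (cong c (sym (min i))) eq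

    from : ∀ i → c (toℕ i) ≡ κ → Adj H (inject₁ i) (suc i)
    from i eq = inj₁ (cong suc (Fin.toℕ-inject₁ i)) , ≡-trans (cong c (min i)) eq

  size-P : ∀ d → size (P d) ≡ d
  size-P d = ≡-trans (size≡edges (P d)) (≡-trans
    (edges-path (P d) red (λ _ → red) id
      (λ { i<j (inj₁ eq) → eq ; i<j (inj₂ eq) → ⊥-elim (<-asym i<j (≤-reflexive eq)) })
      (λ _ _ → refl) (λ i _ → inj₁ (cong suc (Fin.toℕ-inject₁ i))))
    (all-red d))
    where
    all-red : ∀ l → count red (λ _ → red) l ≡ l
    all-red zero    = refl
    all-red (suc l) = cong suc (all-red l)

  P⊆C : ∀ {u v} → Adj (P d) u v → Adj (C (suc d)) u v
  P⊆C uv = (λ u≡v → adj-irrefl (P _) u≡v uv) , Sum.map inj₁ inj₁ uv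

  closing : ∀ {u v} → Adj (C (suc d)) u v → ¬ Adj (P d) u v → Joins (zero , fromℕ d) u v
  closing {d} {u} {v} (_ , inj₁ (inj₁ eq)) ¬uv = ⊥-elim (¬uv (inj₁ eq))
  closing {d} {u} {v} (_ , inj₂ (inj₁ eq)) ¬uv = ⊥-elim (¬uv (inj₂ eq))
  closing {d} {u} {v} (_ , inj₁ (inj₂ (last , first))) _ = inj₂
    ( Fin.toℕ-injective (≡-trans (suc-injective last) (sym (Fin.toℕ-fromℕ d)))
    , Fin.toℕ-injective first)
  closing {d} {u} {v} (_ , inj₂ (inj₂ (last , first))) _ = inj₁
    ( Fin.toℕ-injective first
    , Fin.toℕ-injective (≡-trans (suc-injective last) (sym (Fin.toℕ-fromℕ d))))

  module Copies (R B : Graph n) (total : ∀ {u v} → u ≢ v → Adj R u v ⊎ Adj B u v) where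

    open Balancing R B total public

    private
      Admissible-sym : ∀ κ {u v} → Admissible κ u v → Admissible κ v u
      Admissible-sym red  = adj-sym R
      Admissible-sym blue = adj-sym B

      preferRed-sym : ∀ u v → preferRed u v ≡ preferRed v u
      preferRed-sym u v with adj? R u v | adj? R v u
      ... | yes _  | yes _  = refl
      ... | no _   | no _   = refl
      ... | yes uv | no ¬vu = ⊥-elim (¬vu (adj-sym R uv))
      ... | no ¬uv | yes vu = ⊥-elim (¬uv (adj-sym R vu))

    module _ (p : ColouredPath (m + m) m) where
      open ColouredPath p

      private
        d₂ = m + m

        place : Fin (suc d₂) → Fin n
        place u = vertex (toℕ u)

        place-injective : ∀ {u v} → place u ≡ place v → u ≡ v
        place-injective {u} {v} eq with <-cmp (toℕ u) (toℕ v)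
        ... | tri< u<v _ _ = ⊥-elim (distinct u<v (Fin.toℕ≤pred[n] v) eq)
        ... | tri≈ _ u≡v _ = Fin.toℕ-injective u≡v
        ... | tri> _ _ v<u = ⊥-elim (distinct v<u (Fin.toℕ≤pred[n] u) (sym eq))

        blue-count : count blue colour d₂ ≡ m
        blue-count = +-cancelˡ-≡ m _ _ (≡-trans (cong (_+ count blue colour d₂) (sym red-count))
                                         (count-red+blue colour d₂))

        counts : ∀ κ → count κ colour d₂ ≡ m
        counts red  = red-count
        counts blue = blue-count

        edge-admissible : ∀ {i} κ → i < d₂ → colour i ≡ κ → Admissible κ (vertex i) (vertex (suc i))
        edge-admissible red  = red-edge
        edge-admissible blue = blue-edge

        step-admissible : ∀ κ (u v : Fin (suc d₂)) → suc (toℕ u) ≡ toℕ v → minColour colour u v ≡ κ →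
                          Admissible κ (place u) (place v)
        step-admissible κ u v eq col = subst (Admissible κ (place u) ∘ vertex) eq
          (edge-admissible κ (subst (_≤ d₂) (sym eq) (Fin.toℕ≤pred[n] v))
            (≡-trans (cong colour (sym (m≤n⇒m⊓n≡m (subst (toℕ u ≤_) eq (n≤1+n _))))) col))

        path-admissible : ∀ κ {u v} → Adj (P d₂) u v → minColour colour u v ≡ κ →
                          Admissible κ (place u) (place v)
        path-admissible κ {u} {v} (inj₁ eq) col = step-admissible κ u v eq col
        path-admissible κ {u} {v} (inj₂ eq) col = Admissible-sym κ
          (step-admissible κ v u eq (≡-trans (minColour-sym colour v u) col))

        pathPart : Color → Graph (suc d₂)
        pathPart = colourPart (P d₂) (minColour colour) (minColour-sym colour)

        size-part : ∀ κ → size (pathPart κ) ≡ m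
        size-part κ = ≡-trans (size-pathPart d₂ κ colour) (counts κ)

        -- Path edges keep their colour and the closing edge takes an admissible one. Each class
        -- then has `m` or `m + 1` edges, whichever colour that is.
        cycleColour : Fin (suc d₂) → Fin (suc d₂) → Color
        cycleColour u v with adj? (P d₂) u v
        ... | yes _ = minColour colour u v
        ... | no _  = preferRed (place u) (place v)

        cycleColour-sym : ∀ u v → cycleColour u v ≡ cycleColour v u
        cycleColour-sym u v with adj? (P d₂) u v | adj? (P d₂) v u
        ... | yes _  | yes _  = minColour-sym colour u v
        ... | no _   | no _   = preferRed-sym (place u) (place v)
        ... | yes uv | no ¬vu = ⊥-elim (¬vu (adj-sym (P d₂) uv))
        ... | no ¬uv | yes vu = ⊥-elim (¬uv (adj-sym (P d₂) vu))

        cycleColour-path : ∀ {u v} → Adj (P d₂) u v → cycleColour u v ≡ minColour colour u v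
        cycleColour-path {u} {v} uv with adj? (P d₂) u v
        ... | yes _  = refl
        ... | no ¬uv = ⊥-elim (¬uv uv)

        cycle-admissible : ∀ κ {u v} → Adj (C (suc d₂)) u v × cycleColour u v ≡ κ →
                           Admissible κ (place u) (place v)
        cycle-admissible κ {u} {v} ((u≢v , _) , col) with adj? (P d₂) u v
        ... | yes uv = path-admissible κ uv col
        ... | no _   = subst (λ κ → Admissible κ (place u) (place v)) col
                         (preferRed-admissible (u≢v ∘ place-injective))

        cyclePart : Color → Graph (suc d₂)
        cyclePart = colourPart (C (suc d₂)) cycleColour cycleColour-sym

        cyclePart≥ : ∀ κ → m ≤ size (cyclePart κ)
        cyclePart≥ κ = subst (_≤ size (cyclePart κ)) (size-part κ)
          (size-⊆ (pathPart κ) (cyclePart κ)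
            (λ (uv , col) → P⊆C uv , ≡-trans (cycleColour-path uv) col))

        cyclePart≤ : ∀ κ → size (cyclePart κ) ≤ suc m
        cyclePart≤ κ = begin
          size (cyclePart κ)                  ≤⟨ size-∪ (cyclePart κ) (pathPart κ) rest split ⟩
          size (pathPart κ) + size rest       ≤⟨ +-mono-≤ (≤-reflexive (size-part κ)) rest≤1 ⟩
          m + 1                               ≡⟨ +-comm m 1 ⟩
          suc m                               ∎
          where
          open ≤-Reasoning

          rest : Graph (suc d₂)
          rest = record
            { Adj        = λ u v → Adj (C (suc d₂)) u v × ¬ Adj (P d₂) u v
            ; adj?       = λ u v → adj? (C (suc d₂)) u v ×-dec ¬? (adj? (P d₂) u v)
            ; adj-sym    = λ (uv , ¬uv) → adj-sym (C (suc d₂)) uv , ¬uv ∘ adj-sym (P d₂)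
            ; adj-irrefl = λ u≡v (uv , _) → adj-irrefl (C (suc d₂)) u≡v uv
            }

          split : ∀ {u v} → Adj (cyclePart κ) u v → Adj (pathPart κ) u v ⊎ Adj rest u v
          split {u} {v} (uv , col) with adj? (P d₂) u v
          ... | yes uv′ = inj₁ (uv′ , col)
          ... | no ¬uv  = inj₂ (uv , ¬uv)

          rest≤1 : size rest ≤ 1
          rest≤1 = size≤length rest ((zero , fromℕ d₂) ∷ [])
                     (λ (uv , ¬uv) → _ , here refl , closing uv ¬uv)

      path-copy : BalancedCopy R B (P (m + m))
      path-copy = record
        { embed     = place
        ; injective = place-injective
        ; partition = colourPartition (P d₂) (minColour colour) (minColour-sym colour)
        ; E₁⊆R      = λ (uv , col) → path-admissible red uv col
        ; E₂⊆B      = λ (uv , col) → path-admissible blue uv col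
        ; balanced  = subst (_≤ 1) (sym (≡-trans (cong₂ ∣_-_∣ (size-part red) (size-part blue))
                                                 (∣n-n∣≡0 m))) z≤n
        }

      cycle-copy : BalancedCopy R B (C (suc (m + m)))
      cycle-copy = record
        { embed     = place
        ; injective = place-injective
        ; partition = colourPartition (C (suc d₂)) cycleColour cycleColour-sym
        ; E₁⊆R      = cycle-admissible red
        ; E₂⊆B      = cycle-admissible blue
        ; balanced  = near (cyclePart≥ red) (cyclePart≤ red) (cyclePart≥ blue) (cyclePart≤ blue)
        }
        where
        near : ∀ {a b} → m ≤ a → a ≤ suc m → m ≤ b → b ≤ suc m → ∣ a - b ∣ ≤ 1
        near {a} {b} m≤a a≤ m≤b b≤ with ∣m-n∣≡[m∸n]∨[n∸m] a b
        ... | inj₁ eq = ≤-trans (≤-reflexive eq) (≤-trans (∸-mono a≤ m≤b) (≤-reflexive (m+n∸n≡m 1 m)))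
        ... | inj₂ eq = ≤-trans (≤-reflexive eq) (≤-trans (∸-mono b≤ m≤a) (≤-reflexive (m+n∸n≡m 1 m)))

  -- The extremal colouring

  -- For ε ≤ 1: the j least vertices are joined to everything, and for ε = 1 the vertices
  -- j and j + 1, the only others whose sum is below 2j + 1 + ε, are joined as well.

  Extremal : ∀ n → ℕ → ℕ → Fin n → Fin n → Set
  Extremal n j ε u v = u ≢ v × (toℕ u < j ⊎ toℕ v < j ⊎ toℕ u + toℕ v < ε + suc (j + j))

  extremal : ∀ n → ℕ → ℕ → Graph n
  extremal n j ε = record
    { Adj        = Extremal n j ε
    ; adj?       = λ u v → ¬? (u Fin.≟ v) ×-dec
                     ((toℕ u <? j) ⊎-dec ((toℕ v <? j) ⊎-dec (toℕ u + toℕ v <? ε + suc (j + j))))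
    ; adj-sym    = λ {u} {v} (u≢v , e) → u≢v ∘ sym , flip u v e
    ; adj-irrefl = λ u≡v (u≢v , _) → u≢v u≡v
    }
    where
    flip : ∀ u v → toℕ u < j ⊎ toℕ v < j ⊎ toℕ u + toℕ v < ε + suc (j + j) →
           toℕ v < j ⊎ toℕ u < j ⊎ toℕ v + toℕ u < ε + suc (j + j)
    flip u v (inj₁ u<j)         = inj₂ (inj₁ u<j)
    flip u v (inj₂ (inj₁ v<j))  = inj₁ v<j
    flip u v (inj₂ (inj₂ sum<)) = inj₂ (inj₂ (subst (_< ε + suc (j + j)) (+-comm (toℕ u) (toℕ v)) sum<))

  coextremal : ∀ n → ℕ → ℕ → Graph n
  coextremal n j ε = record
    { Adj        = λ u v → u ≢ v × ¬ Extremal n j ε u v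
    ; adj?       = λ u v → ¬? (u Fin.≟ v) ×-dec ¬? (adj? (extremal n j ε) u v)
    ; adj-sym    = λ (u≢v , ¬e) → u≢v ∘ sym , ¬e ∘ adj-sym (extremal n j ε)
    ; adj-irrefl = λ u≡v (u≢v , _) → u≢v u≡v
    }

  extremalColoring : ∀ n → ℕ → ℕ → TwoColoring n
  extremalColoring n j ε = record
    { E₁ = extremal n j ε
    ; E₂ = coextremal n j ε
    ; E₁⊆G = proj₁
    ; E₂⊆G = proj₁
    ; covers = λ {u} {v} → cover u v
    ; disjoint = λ e (_ , ¬e) → ¬e e
    }
    where
    cover : ∀ u v → u ≢ v → Extremal n j ε u v ⊎ (u ≢ v × ¬ Extremal n j ε u v)
    cover u v u≢v with adj? (extremal n j ε) u v
    ... | yes e = inj₁ e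
    ... | no ¬e = inj₂ (u≢v , ¬e)

  length-preimage : (f : Fin m → Fin n) → (∀ {u v} → f u ≡ f v → u ≡ v) →
                    {Q : ℕ → Set p} (Q? : ∀ i → Dec (Q i)) (is : List ℕ) → (∀ {i} → Q i → i ∈ is) →
                    length (filter (λ u → Q? (toℕ (f u))) (allFin m)) ≤ length is
  length-preimage {m = m} f f-inj {Q} Q? is Q⊆ = subst (_≤ length is) (length-map (toℕ ∘ f) us)
    (unique-⊆⇒length≤ (Unique.map⁺ (f-inj ∘ Fin.toℕ-injective) (Unique.filter⁺ _ (Unique.allFin⁺ m))) image)
    where
    us = filter (λ u → Q? (toℕ (f u))) (allFin m)

    image : ∀ {i} → i ∈ map (toℕ ∘ f) us → i ∈ is
    image i∈ with ∈-map⁻ (toℕ ∘ f) i∈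
    ... | u , u∈ , refl = Q⊆ (proj₂ (∈-filter⁻ (λ u → Q? (toℕ (f u))) {xs = allFin m} u∈))

  module Preimages (f : Fin m → Fin n) (f-inj : ∀ {u v} → f u ≡ f v → u ≡ v) where

    low : ℕ → List (Fin m)
    low j = filter (λ u → toℕ (f u) <? j) (allFin m)

    fibre : ℕ → List (Fin m)
    fibre i = filter (λ u → toℕ (f u) ≟ i) (allFin m)

    -- At most one pair: the preimages of `j` and `j + 1`, the ends of the exceptional edge.
    extra : ℕ → ℕ → List (Fin m × Fin m)
    extra j zero    = []
    extra j (suc _) = cartesianProduct (fibre j) (fibre (suc j))

    length-low : ∀ j → length (low j) ≤ j
    length-low j = subst (length (low j) ≤_) (length-upTo j)
      (length-preimage f f-inj (_<? j) (upTo j) ∈-upTo⁺)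

    length-fibre : ∀ i → length (fibre i) ≤ 1
    length-fibre i = length-preimage f f-inj (_≟ i) (i ∷ []) here

    length-cartesianProduct≤1 : ∀ {us vs : List (Fin m)} → length us ≤ 1 → length vs ≤ 1 →
                                length (cartesianProduct us vs) ≤ 1
    length-cartesianProduct≤1 {[]}                  _ _ = z≤n
    length-cartesianProduct≤1 {u ∷ []} {[]}         _ _ = z≤n
    length-cartesianProduct≤1 {u ∷ []} {v ∷ []}     _ _ = ≤-refl
    length-cartesianProduct≤1 {u ∷ []} {_ ∷ _ ∷ _}  _ (s≤s ())
    length-cartesianProduct≤1 {_ ∷ _ ∷ _}           (s≤s ()) _

    length-extra : ∀ j ε → length (extra j ε) ≤ ε
    length-extra j zero    = z≤n
    length-extra j (suc ε) =
      ≤-trans (length-cartesianProduct≤1 {fibre j} (length-fibre j) (length-fibre (suc j))) (s≤s z≤n)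

    ∈-low : ∀ {j u} → toℕ (f u) < j → u ∈ low j
    ∈-low {j} {u} u<j = ∈-filter⁺ (λ u → toℕ (f u) <? j) (∈-allFin u) u<j

    ∈-fibre : ∀ {i u} → toℕ (f u) ≡ i → u ∈ fibre i
    ∈-fibre {i} {u} eq = ∈-filter⁺ (λ u → toℕ (f u) ≟ i) (∈-allFin u) eq

    -- Two distinct values that are at least `j` sum to at least `2j + 1`, with equality only for
    -- `j` and `j + 1`.
    ∈-extra-< : ∀ j ε → ε ≤ 1 → ∀ {u v} → j ≤ toℕ (f u) → toℕ (f u) < toℕ (f v) →
                toℕ (f u) + toℕ (f v) < ε + suc (j + j) → ∃[ e ] e ∈ extra j ε × Joins e u v
    ∈-extra-< j zero _ {u} {v} j≤u u<v sum< = ⊥-elim (<⇒≱ sum<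
      (subst (_≤ toℕ (f u) + toℕ (f v)) (+-suc j j) (+-mono-≤ j≤u (≤-trans (s≤s j≤u) u<v))))
    ∈-extra-< j (suc zero) _ {u} {v} j≤u u<v sum< = (u , v)
      , ∈-cartesianProduct⁺ (∈-fibre (≤-antisym u≤j j≤u)) (∈-fibre (≤-antisym v≤ (≤-trans (s≤s j≤u) u<v)))
      , inj₁ (refl , refl)
      where
      sum≤ : toℕ (f u) + toℕ (f v) ≤ j + suc j
      sum≤ = subst (toℕ (f u) + toℕ (f v) ≤_) (sym (+-suc j j)) (≤-pred sum<)

      u≤j : toℕ (f u) ≤ j
      u≤j = ≮⇒≥ λ j<u → <⇒≱ (+-mono-<-≤ j<u (≤-trans (s≤s j≤u) u<v)) sum≤

      v≤ : toℕ (f v) ≤ suc j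
      v≤ = +-cancelˡ-≤ j _ _ (≤-trans (+-monoˡ-≤ _ j≤u) sum≤)
    ∈-extra-< j (suc (suc _)) (s≤s ())

    ∈-extra : ∀ j ε → ε ≤ 1 → ∀ {u v} → f u ≢ f v → ¬ toℕ (f u) < j → ¬ toℕ (f v) < j →
              toℕ (f u) + toℕ (f v) < ε + suc (j + j) → ∃[ e ] e ∈ extra j ε × Joins e u v
    ∈-extra j ε ε≤1 {u} {v} fu≢fv u≮j v≮j sum< with <-cmp (toℕ (f u)) (toℕ (f v))
    ... | tri≈ _ eq _  = ⊥-elim (fu≢fv (Fin.toℕ-injective eq))
    ... | tri< u<v _ _ = ∈-extra-< j ε ε≤1 (≮⇒≥ u≮j) u<v sum<
    ... | tri> _ _ v<u with ∈-extra-< j ε ε≤1 (≮⇒≥ v≮j) v<u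
                              (subst (_< ε + suc (j + j)) (+-comm (toℕ (f u)) (toℕ (f v))) sum<)
    ...   | e , e∈ , joins = e , e∈ , Joins-sym joins

  next prev : Fin (suc d) → Fin (suc d)
  next {d} u with suc (toℕ u) <? suc d
  ... | yes u<d = fromℕ< u<d
  ... | no _    = zero
  prev {d} zero    = fromℕ d
  prev     (suc i) = inject₁ i

  NextInCycle : Fin (suc d) → Fin (suc d) → Set
  NextInCycle {d} u v = suc (toℕ u) ≡ toℕ v ⊎ (suc (toℕ u) ≡ suc d × toℕ v ≡ 0)

  next-unique : {u v : Fin (suc d)} → NextInCycle u v → v ≡ next u
  next-unique {d} {u} {v} nxt with suc (toℕ u) <? suc d | nxt
  ... | yes u<d | inj₁ eq           = Fin.toℕ-injective (≡-trans (sym eq) (sym (Fin.toℕ-fromℕ< u<d)))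
  ... | yes u<d | inj₂ (last , _)   = ⊥-elim (<⇒≢ u<d last)
  ... | no u≮d  | inj₁ eq           = ⊥-elim (u≮d (subst (_< suc d) (sym eq) (Fin.toℕ<n v)))
  ... | no _    | inj₂ (_ , first)  = Fin.toℕ-injective first

  prev-unique : {u v : Fin (suc d)} → NextInCycle u v → u ≡ prev v
  prev-unique {d} {u} {zero}  (inj₂ (last , _)) =
    Fin.toℕ-injective (≡-trans (suc-injective last) (sym (Fin.toℕ-fromℕ d)))
  prev-unique {d} {u} {suc v} (inj₁ eq) =
    Fin.toℕ-injective (≡-trans (suc-injective eq) (sym (Fin.toℕ-inject₁ v)))

  -- A red edge of a cycle meets one of the at most j vertices placed on a low vertex, each of
  -- which has only two cycle edges, or it is the exceptional one: at most 2j + ε < m red edges.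
  module _ (R B : Graph n) (j ε : ℕ) (ε≤1 : ε ≤ 1)
           (R⊆ : ∀ {u v} → Adj R u v → Extremal n j ε u v) where

    private
      r = ε + suc (j + j)

    -- Placing `G` between path and cycle handles both targets: the path guarantees `2r` edges in
    -- total, the cycle at most two edges at each vertex.
    no-copy : (G : Graph (suc (r + r))) → (∀ {u v} → Adj (P (r + r)) u v → Adj G u v) →
              (∀ {u v} → Adj G u v → Adj (C (suc (r + r))) u v) → ¬ BalancedCopy R B G
    no-copy G P⊆G G⊆C copy = <⇒≱ few many
      where
      open BalancedCopy copy
      open Preimages embed injective

      es : List (Fin (suc (r + r)) × Fin (suc (r + r)))
      es = map (λ u → u , next u) (low j) ++ map (λ u → u , prev u) (low j) ++ extra j ε

      length-es : length es ≤ j + (j + ε)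
      length-es = begin
        length es
          ≡⟨ length-++ (map (λ u → u , next u) (low j)) ⟩
        length (map (λ u → u , next u) (low j)) + length (map (λ u → u , prev u) (low j) ++ extra j ε)
          ≡⟨ cong₂ _+_ (length-map _ (low j)) (length-++ (map (λ u → u , prev u) (low j))) ⟩
        length (low j) + (length (map (λ u → u , prev u) (low j)) + length (extra j ε))
          ≡⟨ cong (λ l → length (low j) + (l + length (extra j ε))) (length-map _ (low j)) ⟩
        length (low j) + (length (low j) + length (extra j ε))
          ≤⟨ +-mono-≤ (length-low j) (+-mono-≤ (length-low j) (length-extra j ε)) ⟩
        j + (j + ε) ∎
        where open ≤-Reasoning

      ∈-next : ∀ {u v} → NextInCycle u v → toℕ (embed u) < j → ∃[ e ] e ∈ es × Joins e u v
      ∈-next {u} nxt u<j = _ , ∈-++⁺ˡ (∈-map⁺ (λ u → u , next u) (∈-low u<j))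
        , inj₁ (refl , next-unique nxt)

      ∈-prev : ∀ {u v} → NextInCycle u v → toℕ (embed v) < j → ∃[ e ] e ∈ es × Joins e u v
      ∈-prev nxt v<j = _
        , ∈-++⁺ʳ (map (λ u → u , next u) (low j)) (∈-++⁺ˡ (∈-map⁺ (λ u → u , prev u) (∈-low v<j)))
        , inj₂ (prev-unique nxt , refl)

      cover : ∀ {u v} → Adj E₁ u v → ∃[ e ] e ∈ es × Joins e u v
      cover {u} {v} uv with R⊆ (E₁⊆R uv) | G⊆C (E₁⊆G uv)
      ... | eu≢ev , e | _ , cyc with toℕ (embed u) <? j | toℕ (embed v) <? j | e | cyc
      ... | yes u<j | _ | _ | inj₁ nxt = ∈-next nxt u<j
      ... | yes u<j | _ | _ | inj₂ nxt with ∈-prev nxt u<j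
      ...   | _ , e∈ , joins = _ , e∈ , Joins-sym joins
      cover {u} {v} uv | eu≢ev , e | _ , cyc | no _ | yes v<j | _ | inj₁ nxt = ∈-prev nxt v<j
      cover {u} {v} uv | eu≢ev , e | _ , cyc | no _ | yes v<j | _ | inj₂ nxt with ∈-next nxt v<j
      ...   | _ , e∈ , joins = _ , e∈ , Joins-sym joins
      cover uv | eu≢ev , e | _ , cyc | no u≮j | no v≮j | inj₁ u<j        | _ = ⊥-elim (u≮j u<j)
      cover uv | eu≢ev , e | _ , cyc | no u≮j | no v≮j | inj₂ (inj₁ v<j) | _ = ⊥-elim (v≮j v<j)
      cover uv | eu≢ev , e | _ , cyc | no u≮j | no v≮j | inj₂ (inj₂ sum<) | _
        with ∈-extra j ε ε≤1 eu≢ev u≮j v≮j sum<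
      ...   | _ , e∈ , joins = _
        , ∈-++⁺ʳ (map (λ u → u , next u) (low j)) (∈-++⁺ʳ (map (λ u → u , prev u) (low j)) e∈) , joins

      few : size E₁ < r
      few = begin
        suc (size E₁)              ≤⟨ s≤s (≤-trans (size≤length E₁ es cover) length-es) ⟩
        suc (j + (j + ε))          ≡⟨ eq j ε ⟩
        ε + suc (j + j)            ∎
        where
        open ≤-Reasoning
        eq : ∀ j ε → suc (j + (j + ε)) ≡ ε + suc (j + j)
        eq = solve-∀

      total : r + r ≤ size E₁ + size E₂
      total = subst (_≤ size E₁ + size E₂) (size-P (r + r))
        (size-∪ (P (r + r)) E₁ E₂ (covers ∘ P⊆G))

      -- With fewer than `r` red edges out of at least `2r`, blue would lead by two or more.
      many : r ≤ size E₁
      many = ≮⇒≥ λ sparse → <⇒≱ {suc (size E₁)} {size E₂} (blue-heavy sparse) blue-light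
        where
        blue-heavy : size E₁ < r → suc (size E₁) < size E₂
        blue-heavy sparse = +-cancelˡ-< (size E₁) _ _ (begin-strict
          size E₁ + suc (size E₁)  <⟨ +-mono-<-≤ sparse sparse ⟩
          r + r                    ≤⟨ total ⟩
          size E₁ + size E₂        ∎)
          where open ≤-Reasoning

        blue-light : size E₂ ≤ suc (size E₁)
        blue-light = begin
          size E₂                                   ≤⟨ m≤n+∣n-m∣ (size E₂) (size E₁) ⟩
          size E₁ + ∣ size E₁ - size E₂ ∣           ≤⟨ +-monoʳ-≤ (size E₁) balanced ⟩
          size E₁ + 1                               ≡⟨ +-comm (size E₁) 1 ⟩
          suc (size E₁)                             ∎
          where open ≤-Reasoning

  -- Sizes of the extremal colour classes

  edges-lower : ∀ t M (H : Graph n) (f : Fin M → Fin n) ε → ε ≤ 1 → t + (ε + ε) ≤ M →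
                (∀ {i k} → toℕ i < toℕ k → toℕ i < t → Adj H (f i) (f k)) →
                (∀ {i k} → 0 < ε → toℕ i ≡ t → toℕ k ≡ suc t → Adj H (f i) (f k)) →
                t * M + ε ≤ edges H (tabulate f) + tri t
  edges-lower zero M H f zero _ _ _ _ = z≤n
  edges-lower zero (suc (suc M)) H f (suc zero) _ _ _ joined
    rewrite deg-∷-adj H (tabulate (λ i → f (suc (suc i)))) (joined {zero} {suc zero} z<s refl refl) = s≤s z≤n
  edges-lower zero (suc zero) H f (suc zero) _ (s≤s ()) _ _
  edges-lower zero M H f (suc (suc ε)) (s≤s ()) _ _ _
  -- The head is joined to all `M` others, and `(t + 1)(M + 1) - tri (t + 1)` exceeds `t M - tri t`
  -- by exactly `M`.
  edges-lower (suc t) (suc M) H f ε ε≤1 (s≤s room) universal joined =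
    lin-≤ 0 (+-mono-≤ ih (≤-reflexive (sym full)))
      (eq t M ε (deg H (f zero) (tabulate (λ i → f (suc i)))) (edges H (tabulate (λ i → f (suc i)))) (tri t))
    where
    ih : t * M + ε ≤ edges H (tabulate (λ i → f (suc i))) + tri t
    ih = edges-lower t M H (λ i → f (suc i)) ε ε≤1 room
           (λ i<k i<t → universal (s≤s i<k) (s≤s i<t))
           (λ 0<ε i≡t k≡ → joined 0<ε (cong suc i≡t) (cong suc k≡))

    full : deg H (f zero) (tabulate (λ i → f (suc i))) ≡ M
    full = ≡-trans (cong length (filter-all (adj? H (f zero)) (AllP.tabulate⁺ λ (i : Fin M) → universal {zero} {suc i} z<s z<s)))
                   (length-tabulate {n = M} (λ i → f (suc i)))

    eq : ∀ t M ε δ e τ → (suc t * suc M + ε) + ((e + τ) + δ) + 0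
         ≡ ((δ + e) + (suc t + τ)) + ((t * M + ε) + M)
    eq = solve-∀

  module ExtremalSize (n j ε : ℕ) (ε≤1 : ε ≤ 1) (room : j + (ε + ε) ≤ n) where

    size-extremal≥ : j * n + ε ≤ size (extremal n j ε) + tri j
    size-extremal≥ = subst (λ s → j * n + ε ≤ s + tri j) (sym (size≡edges (extremal n j ε)))
      (edges-lower j n (extremal n j ε) id ε ε≤1 room
        (λ i<k i<j → (λ i≡k → <⇒≢ i<k (cong toℕ i≡k)) , inj₁ i<j)
        joined)
      where
      joined : ∀ {i k : Fin n} → 0 < ε → toℕ i ≡ j → toℕ k ≡ suc j → Extremal n j ε i k
      joined {i} {k} 0<ε i≡j k≡ =
        (λ i≡k → 1+n≢n (≡-trans (sym k≡) (≡-trans (cong toℕ (sym i≡k)) i≡j)))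
        , inj₂ (inj₂ (begin-strict
            toℕ i + toℕ k  ≡⟨ cong₂ _+_ i≡j k≡ ⟩
            j + suc j      ≡⟨ +-suc j j ⟩
            suc (j + j)    <⟨ +-monoˡ-≤ (suc (j + j)) 0<ε ⟩
            ε + suc (j + j) ∎))
        where open ≤-Reasoning

    -- For the identity embedding, `low` and `extra` list vertices and pairs of the extremal graph
    -- itself.
    open Preimages {m = n} {n = n} id id

    length-product : ∀ (us vs : List (Fin n)) →
                     length (cartesianProduct us vs) ≡ length us * length vs
    length-product []       vs = refl
    length-product (u ∷ us) vs = ≡-trans (length-++ (map (u ,_) vs))
      (cong₂ _+_ (length-map (u ,_) vs) (length-product us vs))

    size-extremal≤ : size (extremal n j ε) ≤ j * n + ε
    size-extremal≤ = begin
      size (extremal n j ε)   ≤⟨ size≤length (extremal n j ε) es cover ⟩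
      length es               ≡⟨ length-++ (cartesianProduct (low j) (allFin n)) ⟩
      length (cartesianProduct (low j) (allFin n)) + length (extra j ε)
        ≡⟨ cong (_+ length (extra j ε)) (≡-trans (length-product (low j) (allFin n))
             (cong (length (low j) *_) (length-allFin n))) ⟩
      length (low j) * n + length (extra j ε)
        ≤⟨ +-mono-≤ (*-monoˡ-≤ n (length-low j)) (length-extra j ε) ⟩
      j * n + ε ∎
      where
      open ≤-Reasoning
      es = cartesianProduct (low j) (allFin n) ++ extra j ε

      cover : ∀ {u v} → Extremal n j ε u v → ∃[ e ] e ∈ es × Joins e u v
      cover {u} {v} (u≢v , e) with toℕ u <? j | toℕ v <? j | e
      ... | yes u<j | _       | _ = (u , v)
        , ∈-++⁺ˡ (∈-cartesianProduct⁺ (∈-low u<j) (∈-allFin v)) , inj₁ (refl , refl)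
      ... | no _    | yes v<j | _ = (v , u)
        , ∈-++⁺ˡ (∈-cartesianProduct⁺ (∈-low v<j) (∈-allFin u)) , inj₂ (refl , refl)
      ... | no u≮j  | no _    | inj₁ u<j        = ⊥-elim (u≮j u<j)
      ... | no _    | no v≮j  | inj₂ (inj₁ v<j) = ⊥-elim (v≮j v<j)
      ... | no u≮j  | no v≮j  | inj₂ (inj₂ sum<) with ∈-extra j ε ε≤1 u≢v u≮j v≮j sum<
      ...   | _ , e∈ , joins = _ , ∈-++⁺ʳ (cartesianProduct (low j) (allFin n)) e∈ , joins

    size-complete≥ : n * n ≤ size (complete n) + tri n
    size-complete≥ = subst (λ s → n * n ≤ s + tri n) (sym (size≡edges (complete n)))
      (subst (_≤ edges (complete n) (allFin n) + tri n) (+-identityʳ (n * n))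
        (edges-lower n n (complete n) id 0 z≤n (≤-reflexive (+-identityʳ n))
          (λ i<k _ i≡k → <⇒≢ i<k (cong toℕ i≡k)) (λ ())))

    -- Write `x = j * n + ε`. There are at least `2x + 2` edges in all, and red takes at most `x` of
    -- them.
    size-coextremal≥ : 4 * suc (j * n + ε) + n ≤ n * n → j * n + ε ≤ size (coextremal n j ε) + tri j
    size-coextremal≥ small = ≤-trans (*-cancelˡ-≤ 2 (lin-≤ 4
        (+-mono-≤ small (+-mono-≤ (*-monoʳ-≤ 2 size-complete≥) (+-mono-≤ (*-monoʳ-≤ 2 split)
          (≤-reflexive (tri+tri n)))))
        (eq (j * n + ε) n (size (complete n)) (size (extremal n j ε)) (size (coextremal n j ε)) (tri n))))
      (m≤m+n _ (tri j))
      where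
      split : size (complete n) ≤ j * n + ε + size (coextremal n j ε)
      split = ≤-trans (size-∪ (complete n) (extremal n j ε) (coextremal n j ε)
                         (Partition.covers (extremalColoring n j ε)))
                      (+-monoˡ-≤ _ size-extremal≤)

      eq : ∀ x n c r b τ → 2 * x + (n * n + (2 * (c + τ) + (2 * (x + b) + n * suc n))) + 4
           ≡ 2 * b + ((4 * suc x + n) + (2 * (n * n) + (2 * c + (τ + τ))))
      eq = solve-∀

  choose-2 : ∀ n → n choose 2 + n ≡ tri n
  choose-2 zero    = refl
  choose-2 (suc n) = begin
    suc n choose 2 + suc n          ≡⟨ cong (_+ suc n) (nCk+nC[k+1]≡[n+1]C[k+1] n 1) ⟨
    n choose 1 + n choose 2 + suc n ≡⟨ cong (λ x → x + n choose 2 + suc n) (nC1≡n n) ⟩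
    n + n choose 2 + suc n          ≡⟨ eq n (n choose 2) ⟩
    suc n + (n choose 2 + n)        ≡⟨ cong (λ x → suc n + x) (choose-2 n) ⟩
    tri (suc n)                     ∎
    where
    open ≡-Reasoning
    eq : ∀ n c → n + c + suc n ≡ suc n + (c + n)
    eq = solve-∀

-- The balancing numbers and their rational value

module _ where

  open import Defs
  open import Data.Empty using (⊥-elim)
  open import Data.Fin using (Fin)
  open import Data.Integer as ℤ using (ℤ; +_; ∣_∣)
  import Data.Integer.Properties as ℤ
  import Data.Integer.Tactic.RingSolver as ℤ-Solver
  open import Data.List using (allFin)
  import Data.List.Relation.Unary.Unique.Propositional.Properties as Unique
  open import Data.Nat hiding (∣_-_∣)
  open import Data.Nat.Combinatorics using () renaming (_C_ to _choose_)
  open import Data.Nat.Properties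
  open import Data.Nat.Tactic.RingSolver using (solve-∀)
  open import Data.Product using (_×_; _,_; proj₁; proj₂)
  import Data.Rational.Unnormalised as ℚ
  open import Data.Sum using (_⊎_; inj₁; inj₂)
  open import Function using (id)
  open import Relation.Binary.PropositionalEquality
    using (_≡_; _≢_; refl; sym; trans; cong; cong₂; subst; subst₂; module ≡-Reasoning)
  open import Relation.Nullary using (Dec; yes; no; ¬_)

  -- k = j + 1 and α = 2ε - 1.
  module Values (j ε n : ℕ) (ε≤1 : ε ≤ 1) (large : threshold (suc j) ≤ 32 * n) where

    m = ε + suc (j + j)

    b : ℕ
    b = j * n + ε ∸ tri j

    -- `10 + 8 * j` is `2 (2m + 1)` for `ε = 1`, the room that `link` asks for. The other size
    -- conditions follow from it too.
    10+8j≤n : 10 + 8 * j ≤ n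
    10+8j≤n = *-cancelˡ-< 32 (9 + 8 * j) n (lin-≤ (144 * (j * j) + 136 * j + 8) large (eq j n))
      where
      eq : ∀ j n → suc (32 * (9 + 8 * j)) + 32 * n + (144 * (j * j) + 136 * j + 8)
           ≡ 32 * n + (144 * (suc j * suc j) + 104 * suc j + 49)
      eq = solve-∀

    two-paths-fit : suc (m + m) + suc (m + m) ≤ n
    two-paths-fit = lin-≤ 0 (+-mono-≤ 10+8j≤n (*-monoʳ-≤ 4 ε≤1)) (eq j ε n)
      where
      eq : ∀ j ε n → (suc ((ε + suc (j + j)) + (ε + suc (j + j))) + suc ((ε + suc (j + j)) + (ε + suc (j + j))))
           + (n + 4) + 0 ≡ n + ((10 + 8 * j) + 4 * ε)
      eq = solve-∀

    room : j + (ε + ε) ≤ n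
    room = lin-≤ (8 + 7 * j) (+-mono-≤ 10+8j≤n (*-monoʳ-≤ 2 ε≤1)) (eq j ε n)
      where
      eq : ∀ j ε n → j + (ε + ε) + (n + 2) + (8 + 7 * j) ≡ n + ((10 + 8 * j) + 2 * ε)
      eq = solve-∀

    tri≤ : tri j ≤ j * n + ε
    tri≤ = begin
      tri j          ≤⟨ m≤m+n (tri j) (tri j) ⟩
      tri j + tri j  ≡⟨ tri+tri j ⟩
      j * suc j      ≤⟨ *-monoʳ-≤ j (lin-≤ (9 + 7 * j) 10+8j≤n (eq j n)) ⟩
      j * n          ≤⟨ m≤m+n (j * n) ε ⟩
      j * n + ε      ∎
      where
      open ≤-Reasoning
      eq : ∀ j n → suc j + n + (9 + 7 * j) ≡ n + (10 + 8 * j)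
      eq = solve-∀

    b+tri : b + tri j ≡ j * n + ε
    b+tri = m∸n+n≡m tri≤

    -- Equivalently `2 * suc (j * n + ε)` is at most `n choose 2`. As `b ≤ j * n + ε`, this gives
    -- both satisfiability and enough blue edges.
    small : 4 * suc (j * n + ε) + n ≤ n * n
    small = lin-≤ (4 * (j * n) + 8 * n + 2)
      (+-mono-≤ (*-monoʳ-≤ n 10+8j≤n) (+-mono-≤ (*-monoʳ-≤ 4 ε≤1) 10≤n)) (eq j ε n)
      where
      10≤n : 10 ≤ n
      10≤n = ≤-trans (m≤m+n 10 (8 * j)) 10+8j≤n

      eq : ∀ j ε n → (4 * suc (j * n + ε) + n) + (n * n + (4 + n)) + (4 * (j * n) + 8 * n + 2)
           ≡ n * n + (n * (10 + 8 * j) + (4 * ε + 10))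
      eq = solve-∀

    satisfiable : 2 * suc b ≤ n choose 2
    satisfiable = *-cancelˡ-≤ 2 (lin-≤ 0
      (+-mono-≤ small (+-mono-≤ (*-monoʳ-≤ 2 (≤-reflexive (sym (choose-2 n))))
        (+-mono-≤ (≤-reflexive (sym (tri+tri n))) (*-monoʳ-≤ 4 (m∸n≤m (j * n + ε) (tri j))))))
      (eq b (j * n + ε) n (n choose 2) (tri n)))
      where
      eq : ∀ b x n c τ → 2 * (2 * suc b) + (n * n + (2 * (c + n) + ((τ + τ) + 4 * x))) + 0
           ≡ 2 * c + ((4 * suc x + n) + (2 * τ + (n * suc n + 4 * b)))
      eq = solve-∀

    open ExtremalSize n j ε ε≤1 room

    b≤extremal : b ≤ size (extremal n j ε)
    b≤extremal = +-cancelʳ-≤ (tri j) _ _ (subst (_≤ size (extremal n j ε) + tri j) (sym b+tri) size-extremal≥)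

    b≤coextremal : b ≤ size (coextremal n j ε)
    b≤coextremal = +-cancelʳ-≤ (tri j) _ _
      (subst (_≤ size (coextremal n j ε) + tri j) (sym b+tri) (size-coextremal≥ small))

    forest : (G : Graph n) → + b ℤ.< + size G → Forest G m (allFin n)
    forest G b<size = turan G j ε (allFin n) ε≤1 (Unique.allFin⁺ n)
      (subst (λ l → threshold (suc j) ≤ 32 * l) (sym (length-allFin n)) large)
      (subst (λ l → j * l + ε < edges G (allFin n) + tri j) (sym (length-allFin n))
        (subst (λ l → j * n + ε < l + tri j) (size≡edges G)
          (subst (_< size G + tri j) b+tri (+-monoˡ-< (tri j) (ℤ.drop‿+<+ b<size)))))

    module _ (R B : Graph n) (total : ∀ {u v} → u ≢ v → Adj R u v ⊎ Adj B u v)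
             (R-large : + b ℤ.< + size R) (B-large : + b ℤ.< + size B) where

      open Copies R B total

      private
        path : ColouredPath (m + m) m
        path = balanced-path m two-paths-fit (forest R R-large) (forest B B-large)

      path-exists : BalancedCopy R B (P (m + m))
      path-exists = path-copy path

      cycle-exists : BalancedCopy R B (C (suc (m + m)))
      cycle-exists = cycle-copy path

    module _ (G : Graph (suc (m + m)))
             (P⊆G : ∀ {u v} → Adj (P (m + m)) u v → Adj G u v)
             (G⊆C : ∀ {u v} → Adj G u v → Adj (C (suc (m + m))) u v)
             (exists : ∀ (R B : Graph n) → (∀ {u v} → u ≢ v → Adj R u v ⊎ Adj B u v) →
                       + b ℤ.< + size R → + b ℤ.< + size B → BalancedCopy R B G) where

      isBal : IsBal n G (+ b)
      isBal = (subst (ℤ._≤ + (n choose 2)) pos (ℤ.+≤+ satisfiable)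
              , λ χ → exists (Partition.E₁ χ) (Partition.E₂ χ) (Partition.covers χ))
            , least
        where
        pos : + (2 * suc b) ≡ + 2 ℤ.* (+ b ℤ.+ + 1)
        pos = trans (cong (λ c → + (2 * c)) (+-comm 1 b)) (ℤ.pos-* 2 (b + 1))

        least : ∀ i → BalBound n G i → + b ℤ.≤ i
        least i (_ , bound) = ℤ.≮⇒≥ λ i<b →
          no-copy (extremal n j ε) (coextremal n j ε) j ε ε≤1 (λ e → e) G P⊆G G⊆C
            (bound (extremalColoring n j ε)
              (ℤ.<-≤-trans i<b (ℤ.+≤+ b≤extremal)) (ℤ.<-≤-trans i<b (ℤ.+≤+ b≤coextremal)))

      isLbal : IsLbal n G (+ b)
      isLbal = ≤-trans (m≤m+n (suc (m + m)) _) two-paths-fit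
             , (λ L → exists (colorClass L red) (colorClass L blue) (total L)) , least
        where
        total : (L : ListColoring n) → ∀ {u v} → u ≢ v →
                Adj (colorClass L red) u v ⊎ Adj (colorClass L blue) u v
        total L {u} {v} u≢v with ListColoring.lists L u v u≢v
        ... | only red  = inj₁ (u≢v , ∈only)
        ... | only blue = inj₂ (u≢v , ∈only)
        ... | both      = inj₁ (u≢v , ∈both)

        -- The decision is an argument so that symmetry of the lists follows by comparing two
        -- decisions.
        palette : {A : Set} → Dec A → Palette
        palette (yes _) = only red
        palette (no _)  = only blue

        palette-cong : {A B : Set} (a? : Dec A) (b? : Dec B) → (A → B) → (B → A) → palette a? ≡ palette b?
        palette-cong (yes _) (yes _) _ _ = refl
        palette-cong (no _)  (no _)  _ _ = refl
        palette-cong (yes a) (no ¬b) f _ = ⊥-elim (¬b (f a))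
        palette-cong (no ¬a) (yes b) _ g = ⊥-elim (¬a (g b))

        E = extremal n j ε

        -- The extremal 2-coloring with singleton lists.
        L : ListColoring n
        L = record
          { lists     = λ u v _ → palette (adj? E u v)
          ; lists-sym = λ u v _ → palette-cong (adj? E u v) (adj? E v u) (adj-sym E) (adj-sym E)
          }

        red⊆ : ∀ {u v} → Adj (colorClass L red) u v → Adj E u v
        red⊆ {u} {v} (_ , r) with adj? E u v | r
        ... | yes e | _ = e
        ... | no _  | ()

        ⊆red : ∀ {u v} → Adj E u v → Adj (colorClass L red) u v
        ⊆red {u} {v} e with adj? E u v
        ... | yes _ = proj₁ e , ∈only
        ... | no ¬e = ⊥-elim (¬e e)

        ⊆blue : ∀ {u v} → Adj (coextremal n j ε) u v → Adj (colorClass L blue) u v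
        ⊆blue {u} {v} (u≢v , ¬e) with adj? E u v
        ... | yes e = ⊥-elim (¬e e)
        ... | no _  = u≢v , ∈only

        least : ∀ i → LbalBound n G i → + b ℤ.≤ i
        least i bound = ℤ.≮⇒≥ λ i<b →
          no-copy (colorClass L red) (colorClass L blue) j ε ε≤1 red⊆ G P⊆G G⊆C
            (bound L
              (ℤ.<-≤-trans i<b (ℤ.+≤+ (≤-trans b≤extremal (size-⊆ E (colorClass L red) ⊆red))))
              (ℤ.<-≤-trans i<b (ℤ.+≤+ (≤-trans b≤coextremal
                (size-⊆ (coextremal n j ε) (colorClass L blue) ⊆blue)))))

    -- The value of `b` doubled, so that neither `½` nor truncated subtraction remains.
    2b : b + b + j * suc j ≡ 2 * (j * n) + 2 * ε
    2b = begin
      b + b + j * suc j             ≡⟨ cong (λ t → b + b + t) (tri+tri j) ⟨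
      b + b + (tri j + tri j)       ≡⟨ eq₁ b (tri j) ⟩
      (b + tri j) + (b + tri j)     ≡⟨ cong (λ x → x + x) b+tri ⟩
      (j * n + ε) + (j * n + ε)     ≡⟨ eq₂ (j * n) ε ⟩
      2 * (j * n) + 2 * ε           ∎
      where
      open ≡-Reasoning
      eq₁ : ∀ b t → b + b + (t + t) ≡ (b + t) + (b + t)
      eq₁ = solve-∀
      eq₂ : ∀ x ε → (x + ε) + (x + ε) ≡ 2 * x + 2 * ε
      eq₂ = solve-∀

    2bℤ : ∀ α → + (2 * ε) ≡ + 1 ℤ.+ α →
          + b ℤ.+ + b ℤ.+ + j ℤ.* (+ 1 ℤ.+ + j) ≡ + 2 ℤ.* (+ j ℤ.* + n) ℤ.+ (+ 1 ℤ.+ α)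
    2bℤ α ε≡α = begin
      + (b + b) ℤ.+ + j ℤ.* + suc j             ≡⟨ cong (λ t → + (b + b) ℤ.+ t) (ℤ.pos-* j (suc j)) ⟨
      + (b + b + j * suc j)                     ≡⟨ cong +_ 2b ⟩
      + (2 * (j * n)) ℤ.+ + (2 * ε)             ≡⟨ cong₂ ℤ._+_ (ℤ.pos-* 2 (j * n)) ε≡α ⟩
      + 2 ℤ.* + (j * n) ℤ.+ (+ 1 ℤ.+ α)         ≡⟨ cong (λ t → + 2 ℤ.* t ℤ.+ (+ 1 ℤ.+ α)) (ℤ.pos-* j n) ⟩
      + 2 ℤ.* (+ j ℤ.* + n) ℤ.+ (+ 1 ℤ.+ α)     ∎
      where open ≡-Reasoning

    -- Once `ℓ` is a successor, both absolute values compute to the vertex and edge counts wanted.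
    balancing : ∀ {ℓ} → ℓ ≡ + suc (m + m) →
                IsLbal n (C ∣ ℓ ∣) (+ b) × IsBal n (C ∣ ℓ ∣) (+ b) × IsBal n (P ∣ ℓ ℤ.- + 1 ∣) (+ b)
    balancing refl = isLbal (C _) P⊆C id cycle-exists , isBal (C _) P⊆C id cycle-exists
                   , isBal (P _) id P⊆C path-exists

  -- eqˡ and eqʳ start from the unreduced cross products over the denominator 256.
  threshold-≤ : ∀ k n →
                (+ 9 ℚ./ 2) ℚ.* (fromℤ (+ k) ℚ.* fromℤ (+ k)) ℚ.+ (+ 13 ℚ./ 4) ℚ.* fromℤ (+ k)
                  ℚ.+ + 49 ℚ./ 32 ℚ.≤ fromℤ (+ n) →
                threshold k ≤ 32 * n
  threshold-≤ k n (ℚ.*≤* le) = *-cancelˡ-≤ 8 (ℤ.drop‿+≤+ (subst₂ ℤ._≤_ left right le))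
    where
    eqˡ : ∀ x → ((((+ 9 ℤ.* (x ℤ.* x)) ℤ.* + 4 ℤ.+ (+ 13 ℤ.* x) ℤ.* + 2) ℤ.* + 32 ℤ.+ + 49 ℤ.* + 8) ℤ.* + 1)
          ≡ + 8 ℤ.* (+ 144 ℤ.* (x ℤ.* x) ℤ.+ + 104 ℤ.* x ℤ.+ + 49)
    eqˡ = ℤ-Solver.solve-∀

    eqʳ : ∀ y → y ℤ.* + 256 ≡ + 8 ℤ.* (+ 32 ℤ.* y)
    eqʳ = ℤ-Solver.solve-∀

    pos-threshold : + threshold k ≡ + 144 ℤ.* (+ k ℤ.* + k) ℤ.+ + 104 ℤ.* + k ℤ.+ + 49
    pos-threshold = cong₂ (λ x y → x ℤ.+ y ℤ.+ + 49)
      (trans (ℤ.pos-* 144 (k * k)) (cong (+ 144 ℤ.*_) (ℤ.pos-* k k))) (ℤ.pos-* 104 k)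

    left : _ ≡ + (8 * threshold k)
    left = trans (eqˡ (+ k)) (sym (trans (ℤ.pos-* 8 (threshold k)) (cong (+ 8 ℤ.*_) pos-threshold)))

    right : _ ≡ + (8 * (32 * n))
    right = trans (eqʳ (+ n)) (sym (trans (ℤ.pos-* 8 (32 * n)) (cong (+ 8 ℤ.*_) (ℤ.pos-* 32 n))))

  value-≃ : ∀ (j n b α : ℤ) →
            b ℤ.+ b ℤ.+ j ℤ.* (+ 1 ℤ.+ j) ≡ + 2 ℤ.* (j ℤ.* n) ℤ.+ (+ 1 ℤ.+ α) →
            let k = + 1 ℤ.+ j in
            fromℤ b ℚ.≃ (fromℤ k ℚ.- ℚ.1ℚᵘ) ℚ.* fromℤ n
                      ℚ.- ℚ.½ ℚ.* (fromℤ k ℚ.* fromℤ k ℚ.- fromℤ k ℚ.- ℚ.1ℚᵘ ℚ.- fromℤ α)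
  value-≃ j n b α eq = ℚ.*≡* (begin
    -- The right-hand side has denominator 2, coming from `½`; equality is by cross-multiplication.
    b ℤ.* + 2
      ≡⟨ eq₁ b j ⟩
    (b ℤ.+ b ℤ.+ j ℤ.* (+ 1 ℤ.+ j)) ℤ.- j ℤ.* (+ 1 ℤ.+ j)
      ≡⟨ cong (ℤ._- j ℤ.* (+ 1 ℤ.+ j)) eq ⟩
    (+ 2 ℤ.* (j ℤ.* n) ℤ.+ (+ 1 ℤ.+ α)) ℤ.- j ℤ.* (+ 1 ℤ.+ j)
      ≡⟨ eq₂ j n α ⟩
    _ ∎)
    where
    open ≡-Reasoning

    eq₁ : ∀ b j → b ℤ.* + 2 ≡ (b ℤ.+ b ℤ.+ j ℤ.* (+ 1 ℤ.+ j)) ℤ.- j ℤ.* (+ 1 ℤ.+ j)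
    eq₁ = ℤ-Solver.solve-∀

    -- The right-hand side is the unreduced numerator computed by ℚᵘ.
    eq₂ : ∀ j n α → (+ 2 ℤ.* (j ℤ.* n) ℤ.+ (+ 1 ℤ.+ α)) ℤ.- j ℤ.* (+ 1 ℤ.+ j) ≡
          (((((+ 1 ℤ.+ j) ℤ.* + 1 ℤ.+ ℤ.- + 1 ℤ.* + 1) ℤ.* n) ℤ.* + 2 ℤ.+
            (ℤ.- (+ 1 ℤ.* (((((+ 1 ℤ.+ j) ℤ.* (+ 1 ℤ.+ j)) ℤ.* + 1 ℤ.+ (ℤ.- (+ 1 ℤ.+ j)) ℤ.* + 1) ℤ.* + 1
              ℤ.+ ℤ.- + 1 ℤ.* + 1) ℤ.* + 1 ℤ.+ (ℤ.- α) ℤ.* + 1))) ℤ.* + 1)) ℤ.* + 1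
    eq₂ = ℤ-Solver.solve-∀

open import Defs
open import Data.Integer as ℤ using (ℤ; +_; ∣_∣)
import Data.Nat.Tactic.RingSolver as ℕ-Solver
open import Data.Nat as ℕ using (ℕ)
open import Data.Product using (_×_; _,_; ∃-syntax)
open import Data.Rational.Unnormalised using (_+_; _*_; _-_; _/_; _≤_; _≃_; ½; 1ℚᵘ)
open import Data.Sum using (_⊎_; inj₁; inj₂)
open import Relation.Binary.PropositionalEquality using (_≡_; refl; cong)

theorem8 :
  (k n : ℕ) (α : ℤ) →
  1 ℕ.≤ k →
  α ≡ ℤ.- (+ 1) ⊎ α ≡ + 1 →
  let k′ = fromℤ (+ k)
      n′ = fromℤ (+ n)
      α′ = fromℤ α
      ℓ  = + 4 ℤ.* + k ℤ.+ α
  in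
  + 9 / 2 * (k′ * k′) + + 13 / 4 * k′ + + 49 / 32 ≤ n′ →
  ∃[ b ]
    IsLbal n (C ∣ ℓ ∣) b ×
    IsBal n (C ∣ ℓ ∣) b ×
    IsBal n (P ∣ ℓ ℤ.- + 1 ∣) b ×
    fromℤ b ≃ (k′ - 1ℚᵘ) * n′ - ½ * (k′ * k′ - k′ - 1ℚᵘ - α′)
theorem8 (ℕ.suc j) n _ 1≤k (inj₁ refl) large =
  let open Values j 0 n ℕ.z≤n (threshold-≤ (ℕ.suc j) n large)
      lb , bc , bp = balancing (cong +_ (eq j))
  in + b , lb , bc , bp , value-≃ (+ j) (+ n) (+ b) (ℤ.- (+ 1)) (2bℤ (ℤ.- (+ 1)) refl)
  where
  -- The left side is the form to which `4 * suc j - 1` computes over the integers.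
  eq : ∀ j → j ℕ.+ 3 ℕ.* ℕ.suc j ≡ ℕ.suc (ℕ.suc (j ℕ.+ j) ℕ.+ ℕ.suc (j ℕ.+ j))
  eq = ℕ-Solver.solve-∀
theorem8 (ℕ.suc j) n _ 1≤k (inj₂ refl) large =
  let open Values j 1 n (ℕ.s≤s ℕ.z≤n) (threshold-≤ (ℕ.suc j) n large)
      lb , bc , bp = balancing (cong +_ (eq j))
  in + b , lb , bc , bp , value-≃ (+ j) (+ n) (+ b) (+ 1) (2bℤ (+ 1) refl)
  where
  eq : ∀ j → 4 ℕ.* ℕ.suc j ℕ.+ 1 ≡ ℕ.suc ((1 ℕ.+ ℕ.suc (j ℕ.+ j)) ℕ.+ (1 ℕ.+ ℕ.suc (j ℕ.+ j)))
  eq = ℕ-Solver.solve-∀
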